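{- Let $n\ge 1$ be an integer and let $T$ be a tree. Then $$\Upsilon_{h^{(n)}}(T)=\left\lceil\frac{\Upsilon_{h^{(n-1)\perp}}(T)}{n}\right\rceil .$$
   Context: All graphs are finite and simple. An $m$-cube is an $m$-dimensional (closed) unit hypercube; $\mathbf e_1,\mathbf e_2,\dots$ denote standard basis vectors. A graph $G$ is an $n$-cube visibility graph if its vertices can be assigned to pairwise disjoint axis-aligned unit $n$-cubes in $\mathbb{R}^n$ (one cube per vertex) such that two vertices are adjacent if and only if there is an uninterrupted axis-aligned cylindrical channel of positive diameter (parallel to some $\mathbf e_i$, $1\le i\le n$) between their cubes; uninterrupted means that it intersects none of the other cubes. A graph $G$ is an $m$-cube orthogonal visibility graph if its vertices can be assigned to pairwise disjoint unit $m$-cubes in $\mathbb{R}^{m+1}$ aligned with the first $m$ axes, i.e. sets of the form $\prod_{i=1}^m[a_i,a_i+1]\times\{c\}$ (one per vertex), such that two vertices are adjacent if and only if there is a cylindrical channel of positive diameter parallel to $\mathbf e_{m+1}$ between their cubes that intersects none of the other cubes. (For $m=0$ the objects are distinct points of $\mathbb{R}$, and two points see each other when no other point of the representation lies strictly between them.) An $n$-cube visibility forest (resp. $m$-cube orthogonal visibility forest) is a disjoint union of trees each of which is an $n$-cube visibility graph (resp. $m$-cube orthogonal visibility graph). For a graph $G$, $\Upsilon_{h^{(n)}}(G)$ is the minimum $k$ such that $G$ is the union of $k$ subgraphs each of which is an $n$-cube visibility forest, and $\Upsilon_{h^{(m)\perp}}(G)$ is the minimum $k$ such that $G$ is the union of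 $k$ subgraphs each of which is an $m$-cube orthogonal visibility forest. -}

module Defs where

open import Algebra.Bundles using (CommutativeRing)
import Algebra.Properties.Monoid.Sum as MonoidSum
open import Data.Bool using (Bool; T; if_then_else_)
open import Data.Fin using (Fin; zero; suc; inject₁; fromℕ; _≟_)
open import Data.Fin.Subset using (Subset; Nonempty; _∈_)
open import Data.Nat as ℕ using (ℕ; suc)
open import Data.Product using (∃-syntax; Σ-syntax; _×_)
open import Data.Sum using (_⊎_)
open import Function.Bundles using (_⇔_)
open import Function.Definitions using (Injective)
open import Level using (0ℓ)
open import Relation.Binary.Core using (Rel)
open import Relation.Binary.Construct.Closure.ReflexiveTransitive using (Star)
open import Relation.Binary.PropositionalEquality using (_≡_; _≢_)
open import Relation.Binary.Structures using (IsTotalOrder)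
open import Relation.Nullary using (¬_; does)
open import Relation.Unary using (Pred; Satisfiable; Empty; U; _∩_)

------------------------------------------------------------------------
-- Real numbers

-- The axioms of a Dedekind-complete ordered field, which classically
-- determine ℝ up to isomorphism.  The order is read classically: statements
-- about Reals are meant to be used together with excluded middle.
record Reals : Set₁ where
  field
    commutativeRing : CommutativeRing 0ℓ 0ℓ
  open CommutativeRing commutativeRing public

  infix 4 _≤_ _<_
  field
    _≤_          : Rel Carrier 0ℓ
    isTotalOrder : IsTotalOrder _≈_ _≤_
    0≉1          : ¬ 0# ≈ 1#
    inverse      : ∀ x → ¬ x ≈ 0# → ∃[ y ] x * y ≈ 1#
    +-monoʳ-≤    : ∀ x {y z} → y ≤ z → x + y ≤ x + z
    *-nonNeg     : ∀ {x y} → 0# ≤ x → 0# ≤ y → 0# ≤ x * y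

  _<_ : Rel Carrier 0ℓ
  x < y = x ≤ y × ¬ x ≈ y

  IsUpperBound : Pred Carrier 0ℓ → Pred Carrier 0ℓ
  IsUpperBound S b = ∀ x → S x → x ≤ b

  field
    supremum : ∀ (S : Pred Carrier 0ℓ) →
               Satisfiable S → Satisfiable (IsUpperBound S) →
               ∃[ s ] (IsUpperBound S s × (∀ b → IsUpperBound S b → s ≤ b))

------------------------------------------------------------------------
-- Graphs

-- Finite simple graphs whose vertex set is a subset of Fin N.  Fixing the
-- ambient set Fin N lets a graph and its subgraphs share one type.
record Graph (N : ℕ) : Set where
  field
    vertices : Subset N
    adj      : Fin N → Fin N → Bool

  Adj : Rel (Fin N) 0ℓ
  Adj u v = T (adj u v)

  field
    adj-vertex : ∀ {u v} → Adj u v → u ∈ vertices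
    adj-sym    : ∀ {u v} → Adj u v → Adj v u
    adj-irrefl : ∀ {v} → ¬ Adj v v

open Graph public

-- Any family whose union is G automatically consists of subgraphs of G.
IsUnion : ∀ {N k} → Graph N → (Fin k → Graph N) → Set
IsUnion G H =
  (∀ v → v ∈ vertices G ⇔ (∃[ i ] v ∈ vertices (H i))) ×
  (∀ u v → Adj G u v ⇔ (∃[ i ] Adj (H i) u v))

IsDisjointUnion : ∀ {N k} → Graph N → (Fin k → Graph N) → Set
IsDisjointUnion G H =
  IsUnion G H ×
  (∀ i j → i ≢ j → ∀ v → v ∈ vertices (H i) → ¬ v ∈ vertices (H j))

Connected : ∀ {N} → Graph N → Set
Connected G = ∀ u v → u ∈ vertices G → v ∈ vertices G → Star (Adj G) u v

-- A cycle through the 3 + k distinct vertices c 0, …, c (2 + k).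
IsCycle : ∀ {N} → Graph N → (k : ℕ) → (Fin (3 ℕ.+ k) → Fin N) → Set
IsCycle G k c =
  Injective _≡_ _≡_ c ×
  (∀ (i : Fin (2 ℕ.+ k)) → Adj G (c (inject₁ i)) (c (suc i))) ×
  Adj G (c (fromℕ (2 ℕ.+ k))) (c zero)

Acyclic : ∀ {N} → Graph N → Set
Acyclic G = ∀ k c → ¬ IsCycle G k c

IsTree : ∀ {N} → Graph N → Set
IsTree G = Nonempty (vertices G) × Connected G × Acyclic G

GraphClass : Set₁
GraphClass = ∀ {N} → Graph N → Set

ForestOf : GraphClass → GraphClass
ForestOf 𝒫 {N} G =
  Σ[ q ∈ ℕ ] Σ[ C ∈ (Fin q → Graph N) ]
    (IsDisjointUnion G C × (∀ i → IsTree (C i) × 𝒫 (C i)))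

UnionOf : GraphClass → ℕ → GraphClass
UnionOf 𝒫 k {N} G =
  Σ[ H ∈ (Fin k → Graph N) ] (IsUnion G H × (∀ i → 𝒫 (H i)))

IsMinimum : Pred ℕ 0ℓ → ℕ → Set
IsMinimum P k = P k × (∀ j → P j → k ℕ.≤ j)

------------------------------------------------------------------------
-- Cube visibility

module _ (ℝ : Reals) where
  open Reals ℝ
  open MonoidSum +-monoid using (sum)

  Point : ℕ → Set
  Point d = Fin d → Carrier

  Body : ℕ → Set₁
  Body d = Pred (Point d) 0ℓ

  Disjoint : ∀ {d} → Body d → Body d → Set
  Disjoint A B = Empty (A ∩ B)

  Cube : ∀ {n} → Point n → Body n
  Cube a x = ∀ i → a i ≤ x i × x i ≤ a i + 1#

  -- ∏ᵢ [aᵢ , aᵢ + 1] × {c}, with the degenerate coordinate last.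
  Panel : ∀ {m} → Point m → Carrier → Body (suc m)
  Panel {m} a c x =
    (∀ i → a i ≤ x (inject₁ i) × x (inject₁ i) ≤ a i + 1#) × x (fromℕ m) ≈ c

  -- Squared Euclidean distance after projecting away coordinate i.
  distance² : ∀ {d} → Fin d → Point d → Point d → Carrier
  distance² i x p =
    sum (λ j → if does (j ≟ i) then 0# else (x j - p j) * (x j - p j))

  -- The round cylinder of radius r parallel to eᵢ, around the axis through
  -- p, between the heights s and t.
  Cylinder : ∀ {d} → Fin d → Point d → (r s t : Carrier) → Body d
  Cylinder i p r s t x = distance² i x p ≤ r * r × s ≤ x i × x i ≤ t

  -- A family of bodies indexed by Fin N is only relevant on the vertex set V.
  module _ {d N} (V : Subset N) (S : Fin N → Body d) where

    -- A channel parallel to eᵢ whose bottom disc lies in S u and whose top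
    -- disc lies in S v.
    Channel↑ : Fin d → Fin N → Fin N → Set
    Channel↑ i u v =
      Σ[ p ∈ Point d ] Σ[ r ∈ Carrier ] Σ[ s ∈ Carrier ] Σ[ t ∈ Carrier ]
        (0# < r × s ≤ t ×
         (∀ x → Cylinder i p r s t x → x i ≈ s → S u x) ×
         (∀ x → Cylinder i p r s t x → x i ≈ t → S v x) ×
         (∀ w → w ∈ V → w ≢ u → w ≢ v → Disjoint (Cylinder i p r s t) (S w)))

    Channel : Fin d → Fin N → Fin N → Set
    Channel i u v = Channel↑ i u v ⊎ Channel↑ i v u

  -- The bodies S represent G when channels are allowed in the directions eᵢ
  -- with i in I.
  Represents : ∀ {d N} → Pred (Fin d) 0ℓ → (Fin N → Body d) → Graph N → Set
  Represents I S G =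
    (∀ u v → u ∈ V → v ∈ V → u ≢ v → Disjoint (S u) (S v)) ×
    (∀ u v → u ∈ V → v ∈ V → u ≢ v →
       Adj G u v ⇔ (∃[ i ] (I i × Channel V S i u v)))
    where V = vertices G

  CubeVisibility : ℕ → GraphClass
  CubeVisibility n {N} G =
    Σ[ a ∈ (Fin N → Point n) ] Represents U (λ v → Cube (a v)) G

  CubeOrthogonalVisibility : ℕ → GraphClass
  CubeOrthogonalVisibility m {N} G =
    Σ[ a ∈ (Fin N → Point m) ] Σ[ c ∈ (Fin N → Carrier) ]
      Represents (_≡ fromℕ m) (λ v → Panel (a v) (c v)) G

  -- Υh n G k : the number Υ_{h^(n)}(G) is k.
  Υh : ℕ → ∀ {N} → Graph N → ℕ → Set
  Υh n G = IsMinimum (λ k → UnionOf (ForestOf (CubeVisibility n)) k G)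

  -- Υh⊥ m G k : the number Υ_{h^(m)⊥}(G) is k.
  Υh⊥ : ℕ → ∀ {N} → Graph N → ℕ → Set
  Υh⊥ m G = IsMinimum (λ k → UnionOf (ForestOf (CubeOrthogonalVisibility m)) k G)

{-# OPTIONS --safe #-}

-- A channel can be replaced by a single point of the cross-section lying in
-- half-open boxes.  In these terms a connected subgraph of an acyclic graph
-- inherits its panel layout, since a line of sight that opens up when panels
-- are removed would close a cycle.  So the edges of an n-cube visibility tree
-- seen in direction i form an (n-1)-cube orthogonal visibility forest.
--
-- Conversely, let a tree be the union of n such forests.  Colour each edge by
-- the first forest containing it; the tree is then glued from connected
-- monochromatic parts, each with a panel layout.  Coordinate j of a cube is the
-- sum of its panel coordinates in the parts of colours other than j (a vertex
-- outside a part inherits the coordinates of the vertex of the part nearest to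
-- it), plus large multiples of the heights in the parts of colour j and of an
-- index separating vertices whose connecting path uses colour j.  Cubes that
-- overlap in coordinate j are thus joined by a path avoiding colour j, and cubes
-- that overlap in all coordinates but i lie in a common part of colour i, where
-- they see each other exactly as the panels do.
--
-- Hence k forests of n-cube visibility trees suffice if and only if k * n
-- orthogonal forests do.
module Submission where

open import Defs
open import Axiom.ExcludedMiddle using (ExcludedMiddle)
import Algebra.Properties.CommutativeMonoid.Sum as SumProperties
import Algebra.Properties.CommutativeSemigroup as SemigroupProperties
import Algebra.Properties.Ring as RingProperties
import Algebra.Solver.Ring.NaturalCoefficients.Default as NaturalSolver
import Data.Bool as Bool
open import Data.Bool using (if_then_else_)
open import Data.Empty using (⊥; ⊥-elim)
open import Data.Fin using (Fin; zero; suc; inject₁; fromℕ; fromℕ<; toℕ; _≟_; punchIn; punchOut; combine; remQuot)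
open import Data.Fin.Properties using (any?; suc-injective; toℕ<n; toℕ-injective; toℕ-fromℕ<; remQuot-combine; combine-remQuot; punchInᵢ≢i; punchIn-punchOut; punchOut-punchIn; punchOut-cong)
open import Data.Fin.Subset using (Subset; Nonempty; _∈_)
open import Data.Integer as ℤ using (+_)
import Data.Integer.Properties as ℤₚ
open import Data.List using (List; filter; length; allFin) renaming (lookup to lookupᴸ)
open import Data.List.Membership.Propositional.Properties using (∈-filter⁺; ∈-filter⁻; ∈-allFin; ∈-lookup)
import Data.List.Relation.Unary.All as All
import Data.List.Relation.Unary.AllPairs as AllPairs
open import Data.List.Relation.Unary.Any using (index)
open import Data.List.Relation.Unary.Any.Properties using (lookup-index)
open import Data.List.Relation.Unary.Unique.Propositional using (Unique)
open import Data.List.Relation.Unary.Unique.Propositional.Properties using (filter⁺; allFin⁺)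
open import Data.Nat as ℕ using (ℕ; zero; suc; pred; NonZero)
import Data.Nat.DivMod as ℕ
import Data.Nat.Properties as ℕₚ
open import Data.Product using (∃; ∃-syntax; Σ-syntax; _×_; _,_; proj₁; proj₂; map₂)
open import Data.Rational.Unnormalised using (_/_; ceiling)
open import Data.Sum as Sum using (_⊎_; inj₁; inj₂; [_,_])
open import Data.Vec using (tabulate)
open import Data.Vec.Functional using (insertAt)
open import Data.Vec.Functional.Properties using (insertAt-lookup; insertAt-punchIn)
open import Data.Vec.Properties using (lookup∘tabulate; lookup⇒[]=; []=⇒lookup)
open import Function using (_∘_; _on_; _⇔_; mk⇔; Equivalence)
open import Function.Definitions using (Injective)
open import Level using (0ℓ)
import Relation.Binary.Construct.NonStrictToStrict as Strict
open import Relation.Binary.Construct.Closure.ReflexiveTransitive using (Star; ε; _◅_; _◅◅_; reverse) renaming (map to mapStar)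
open import Relation.Binary.Core using (Rel)
open import Relation.Binary.Definitions using (Symmetric; tri<; tri≈; tri>)
open import Relation.Binary.PropositionalEquality as ≡ using (_≡_; _≢_; cong; subst)
import Relation.Binary.Reasoning.Setoid as SetoidReasoning
open import Relation.Binary.Structures using (IsTotalOrder)
open import Relation.Nullary using (¬_; Dec; yes; no; does; contradiction)
open import Relation.Nullary.Decidable using (toWitness; fromWitness; ⌊_⌋; dec-true; decidable-stable)
open import Relation.Unary using (Pred; U)

open Equivalence using (to; from)

-- Subgraphs, simple paths and bridges.

private variable
  N : ℕ
  G H K : Graph N

infix 4 _⊑_

record _⊑_ (H G : Graph N) : Set where
  constructor _,_
  field
    vertex : ∀ {v} → v ∈ vertices H → v ∈ vertices G
    edge   : ∀ {u v} → Adj H u v → Adj G u v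

open _⊑_ public

⊑-trans : K ⊑ H → H ⊑ G → K ⊑ G
⊑-trans p q = (λ v → vertex q (vertex p v)) , (λ e → edge q (edge p e))

acyclic-⊑ : H ⊑ G → Acyclic G → Acyclic H
acyclic-⊑ H⊑G acyclic k c (inj , steps , close) =
  acyclic k c (inj , (λ i → edge H⊑G (steps i)) , edge H⊑G close)

-- The vertices are listed as in `IsCycle`, so a path with at least three vertices becomes a cycle
-- as soon as an edge joins its ends.
record SimplePath (R : Rel (Fin N) 0ℓ) (x y : Fin N) : Set where
  field
    size      : ℕ
    at        : Fin (suc size) → Fin N
    injective : Injective _≡_ _≡_ at
    start     : at zero ≡ x
    finish    : at (fromℕ size) ≡ y
    step      : ∀ i → R (at (inject₁ i)) (at (suc i))

suffix : ∀ {R : Rel (Fin N) 0ℓ} {y} k (at : Fin (suc k) → Fin N) →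
         Injective _≡_ _≡_ at → at (fromℕ k) ≡ y →
         (∀ i → R (at (inject₁ i)) (at (suc i))) →
         ∀ i → SimplePath R (at i) y
suffix k at inj fin st zero = record
  { size = k ; at = at ; injective = inj ; start = ≡.refl ; finish = fin ; step = st }
suffix (suc k) at inj fin st (suc i) =
  suffix k (at ∘ suc) (λ eq → suc-injective (inj eq)) fin (λ j → st (suc j)) i

-- Loop erasure: if the new first vertex already occurs on the simplified tail, the path is cut down
-- to the suffix starting there.
simplePath : ∀ {R : Rel (Fin N) 0ℓ} {x y} → Star R x y → SimplePath R x y
simplePath {x = x} ε = record
  { size = 0 ; at = λ _ → x ; injective = λ { {zero} {zero} _ → ≡.refl }
  ; start = ≡.refl ; finish = ≡.refl ; step = λ () }
simplePath {N} {R} {x = x} {y} (r ◅ rs) with simplePath rs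
... | p with any? (λ i → SimplePath.at p i ≟ x)
... | yes (i , ≡.refl) = suffix _ at injective finish step i
  where open SimplePath p
... | no x∉p = record
  { size = suc size ; at = at′ ; injective = inj′ ; start = ≡.refl
  ; finish = finish ; step = step′ }
  where
  open SimplePath p
  at′ : Fin (suc (suc size)) → Fin N
  at′ zero    = x
  at′ (suc i) = at i
  inj′ : Injective _≡_ _≡_ at′
  inj′ {zero}  {zero}  _  = ≡.refl
  inj′ {zero}  {suc j} eq = contradiction (j , ≡.sym eq) x∉p
  inj′ {suc i} {zero}  eq = contradiction (i , eq) x∉p
  inj′ {suc i} {suc j} eq = cong suc (injective eq)
  step′ : ∀ i → R (at′ (inject₁ i)) (at′ (suc i))
  step′ zero    = subst (R x) (≡.sym start) r
  step′ (suc i) = step i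

Minus : Graph N → (x y : Fin N) → Rel (Fin N) 0ℓ
Minus G x y a b = Adj G a b × ¬ (a ≡ x × b ≡ y) × ¬ (a ≡ y × b ≡ x)

Minus-sym : ∀ (G : Graph N) {x y} → Symmetric (Minus G x y)
Minus-sym G (e , p , q) =
  adj-sym G e , (λ (a , b) → q (b , a)) , (λ (a , b) → p (b , a))

-- A walk avoiding the edge can be made simple. Size zero would make the edge a loop, size one would
-- make the path the deleted edge itself, and any longer path is closed to a cycle by the edge.
bridge : Acyclic G → ∀ {x y} → Adj G x y → ¬ Star (Minus G x y) x y
bridge {G = G} acyclic {x} {y} e walk = go size at injective start finish step
  where
  open SimplePath (simplePath walk)
  go : ∀ k (at : Fin (suc k) → _) → Injective _≡_ _≡_ at →
       at zero ≡ x → at (fromℕ k) ≡ y →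
       (∀ i → Minus G x y (at (inject₁ i)) (at (suc i))) → ⊥
  go zero at inj ≡.refl ≡.refl st = adj-irrefl G e
  go (suc zero) at inj ≡.refl ≡.refl st = proj₁ (proj₂ (st zero)) (≡.refl , ≡.refl)
  go (suc (suc k)) at inj ≡.refl ≡.refl st =
    acyclic k at (inj , (λ i → proj₁ (st i)) , adj-sym G e)

steps : ∀ {R : Rel (Fin N) 0ℓ} {x y} → Star R x y → ℕ
steps ε        = 0
steps (_ ◅ rs) = suc (steps rs)

∈-Star : ∀ {R : Rel (Fin N) 0ℓ} (S : Pred (Fin N) 0ℓ) →
         (∀ {x y} → S x → R x y → S y) → ∀ {x y} → S x → Star R x y → S y
∈-Star S closed s ε        = s
∈-Star S closed s (r ◅ rs) = ∈-Star S closed (closed s r) rs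

-- An edge of `H` lies in some piece, and disjointness forces this to be the piece of either
-- endpoint. Walks in `K` therefore never leave the piece in which they start.
component-⊑ : ∀ {q} {C : Fin q → Graph N} → IsDisjointUnion H C →
              K ⊑ H → Connected K → ∀ {x i} → x ∈ vertices K → x ∈ vertices (C i) →
              K ⊑ C i
component-⊑ {H = H} {K} {C = C} ((_ , edges) , disjoint) K⊑H connected {x} {i} x∈K x∈C =
  inC , λ e → edgeC (inC (adj-vertex K e)) (edge K⊑H e)
  where
  edgeC : ∀ {u v} → u ∈ vertices (C i) → Adj H u v → Adj (C i) u v
  edgeC {u} {v} u∈C e with to (edges u v) e
  ... | j , e′ with i ≟ j
  ... | yes ≡.refl = e′
  ... | no i≢j = contradiction (adj-vertex (C j) e′) (disjoint i j i≢j u u∈C)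
  inC : ∀ {v} → v ∈ vertices K → v ∈ vertices (C i)
  inC {v} v∈K = ∈-Star (_∈ vertices (C i))
    (λ u∈C e → adj-vertex (C i) (adj-sym (C i) (edgeC u∈C (edge K⊑H e))))
    x∈C (connected x v x∈K v∈K)

-- Walks, components and forests under excluded middle.

module Classical (em : ExcludedMiddle 0ℓ) where

  decide : (P : Set) → Dec P
  decide P = em

  bool : Set → Bool.Bool
  bool P = ⌊ decide P ⌋

  bool⁺ : ∀ {P} → P → Bool.T (bool P)
  bool⁺ = fromWitness

  bool⁻ : ∀ {P} → Bool.T (bool P) → P
  bool⁻ = toWitness

  ⟦_⟧ : Pred (Fin N) 0ℓ → Subset N
  ⟦ P ⟧ = tabulate (λ v → does (decide (P v)))

  ⟦⟧⁺ : ∀ {P : Pred (Fin N) 0ℓ} {v} → P v → v ∈ ⟦ P ⟧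
  ⟦⟧⁺ {P = P} {v} p = lookup⇒[]= v _ (≡.trans (lookup∘tabulate _ v) (dec-true (decide (P v)) p))

  ⟦⟧⁻ : ∀ {P : Pred (Fin N) 0ℓ} {v} → v ∈ ⟦ P ⟧ → P v
  ⟦⟧⁻ {P = P} {v} v∈ with decide (P v) in eq
  ... | yes p = p
  ... | no ¬p with () ← ≡.trans (cong does (≡.sym eq)) (≡.trans (≡.sym (lookup∘tabulate _ v)) ([]=⇒lookup v∈))

  -- Adjacency is Boolean and vertex sets are vectors, so excluded middle is what lets arbitrary
  -- predicates and relations define graphs.
  graph : (V : Pred (Fin N) 0ℓ) (E : Rel (Fin N) 0ℓ) → (∀ {u v} → E u v → V u) →
          Symmetric E → (∀ {v} → ¬ E v v) → Graph N
  graph V E E⇒V sym-E irrefl-E = record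
    { vertices   = ⟦ V ⟧
    ; adj        = λ u v → bool (E u v)
    ; adj-vertex = λ e → ⟦⟧⁺ (E⇒V (bool⁻ e))
    ; adj-sym    = λ e → bool⁺ (sym-E (bool⁻ e))
    ; adj-irrefl = λ e → irrefl-E (bool⁻ e)
    }

  -- The first step that enters `S`. The rest of the walk is returned with a length bound because
  -- `meet′` recurses on it.
  crossing : ∀ {R : Rel (Fin N) 0ℓ} (S : Pred (Fin N) 0ℓ) {x y}
             (rs : Star R x y) → ¬ S x → S y →
             ∃[ a ] ∃[ b ] (¬ S a × R a b × S b ×
               Σ[ rs′ ∈ Star R b y ] steps rs′ ℕ.< steps rs)
  crossing S ε ¬Sx Sy = contradiction Sy ¬Sx
  crossing S (_◅_ {j = z} r rs) ¬Sx Sy with decide (S z)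
  ... | yes Sz = _ , z , ¬Sx , r , Sz , rs , ℕₚ.≤-refl
  ... | no ¬Sz with crossing S rs ¬Sz Sy
  ... | a , b , p , q , s , rs′ , lt = a , b , p , q , s , rs′ , ℕₚ.m≤n⇒m≤1+n lt

  module _ (acyclic : Acyclic G) {P Q : Rel (Fin _) 0ℓ}
           (P⊆G : ∀ {x y} → P x y → Adj G x y) (Q⊆G : ∀ {x y} → Q x y → Adj G x y) where

    private
      -- Induction on a bound for the length of `ps`. Its first edge, from `u` to `y`, is a bridge;
      -- consider the side of `y` after its deletion. If `w` is on that side, `qs` must cross over,
      -- and any crossing edge other than the bridge would put both its ends on the same side; so
      -- `qs` uses the bridge and the recursion continues from `y`. Otherwise `ps` must come back to
      -- `u`, and this detour is dropped.
      meet′ : ∀ k {u w} (ps : Star P u w) → steps ps ℕ.≤ k → Star Q u w →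
              Star (λ x y → P x y × Q x y) u w
      meet′ k ε _ _ = ε
      meet′ (suc k) {u} {w} (_◅_ {j = y} p ps) (ℕ.s≤s le) qs with decide (Star (Minus G u y) w y)
      ... | yes Sw with crossing (λ a → Star (Minus G u y) a y) qs (bridge {G = G} acyclic (P⊆G p)) Sw
      ...   | a , b , ¬Sa , q , Sb , qs′ , _ with a ≟ u | b ≟ y
      ...     | yes ≡.refl | yes ≡.refl = (p , q) ◅ meet′ k ps le qs′
      ...     | no a≢u | _ = contradiction
                ((Q⊆G q , (λ (eq , _) → a≢u eq) , λ { (≡.refl , _) → ¬Sa ε }) ◅ Sb) ¬Sa
      ...     | yes ≡.refl | no b≢y = contradiction
                ((Q⊆G q , (λ (_ , eq) → b≢y eq) , λ { (≡.refl , _) → ¬Sa ε }) ◅ Sb) ¬Sa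
      meet′ (suc k) {u} {w} (_◅_ {j = y} p ps) (ℕ.s≤s le) qs
          | no ¬Sw with crossing (λ a → ¬ Star (Minus G u y) a y) ps (λ ¬Sy → ¬Sy ε) ¬Sw
      ...   | a , b , ¬¬Sa , p′ , ¬Sb , ps′ , lt with b ≟ u
      ...     | yes ≡.refl = meet′ k ps′ (ℕₚ.≤-trans (ℕₚ.<⇒≤ lt) le) qs
      ...     | no b≢u = contradiction (λ Sa → ¬Sb
                (Minus-sym G (P⊆G p′ , (λ { (_ , ≡.refl) → ¬Sb ε }) , λ (_ , eq) → b≢u eq) ◅ Sa)) ¬¬Sa

    -- In an acyclic graph all walks between two vertices contain the unique
    -- simple path between them.
    meet : ∀ {u w} → Star P u w → Star Q u w → Star (λ x y → P x y × Q x y) u w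
    meet ps qs = meet′ (steps ps) ps ℕₚ.≤-refl qs

  -- `meet` is applied to one relation at a time; the walk `gs` settles the empty intersection.
  ⋂-meet : Acyclic G → ∀ {k u w} {R : Fin k → Rel (Fin N) 0ℓ} →
           (∀ i {x y} → R i x y → Adj G x y) →
           Star (Adj G) u w → (∀ i → Star (R i) u w) →
           Star (λ x y → Adj G x y × (∀ i → R i x y)) u w
  ⋂-meet acyclic {zero} R⊆G gs rs = mapStar (λ e → e , λ ()) gs
  ⋂-meet {G = G} acyclic {suc k} {R = R} R⊆G gs rs =
    mapStar (λ ((e , r′) , r) → e , λ { zero → r ; (suc i) → r′ i })
      (meet {G = G} acyclic proj₁ (R⊆G zero)
        (⋂-meet {G = G} acyclic (λ i → R⊆G (suc i)) gs (λ i → rs (suc i))) (rs zero))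

  least : ∀ {k} (P : Pred (Fin k) 0ℓ) → ∃ P → ∃[ x ] (P x × ∀ y → P y → toℕ x ℕ.≤ toℕ y)
  least {suc k} P (x , Px) with decide (P zero)
  ... | yes P0 = zero , P0 , λ _ _ → ℕ.z≤n
  least {suc k} P (zero , Px)  | no ¬P0 = contradiction Px ¬P0
  least {suc k} P (suc x , Px) | no ¬P0 with least (P ∘ suc) (x , Px)
  ... | y , Py , min = suc y , Py , λ { zero p → contradiction p ¬P0 ; (suc z) p → ℕ.s≤s (min z p) }

  module _ {R : Rel (Fin N) 0ℓ} (R-sym : Symmetric R) where

    -- A canonical element of each connectivity class. It serves both to index components and,
    -- through its number, to place classes on the real line.
    representative : Fin N → Fin N
    representative v = proj₁ (least (λ u → Star R u v) (v , ε))

    representative-Star : ∀ v → Star R (representative v) v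
    representative-Star v = proj₁ (proj₂ (least (λ u → Star R u v) (v , ε)))

    representative-cong : ∀ {v w} → Star R v w → representative v ≡ representative w
    representative-cong {v} {w} rs = toℕ-injective (ℕₚ.≤-antisym
      (minimal v (representative-Star w ◅◅ reverse R-sym rs))
      (minimal w (representative-Star v ◅◅ rs)))
      where
      minimal : ∀ v {u} → Star R u v → toℕ (representative v) ℕ.≤ toℕ u
      minimal v {u} = proj₂ (proj₂ (least (λ u → Star R u v) (v , ε))) u

    representative-reflects : ∀ {v w} → representative v ≡ representative w → Star R v w
    representative-reflects {v} {w} eq = reverse R-sym (representative-Star v)
      ◅◅ subst (λ r → Star R r w) (≡.sym eq) (representative-Star w)

  module _ (G : Graph N) where

    root : Fin N → Fin N
    root = representative (λ {u} {v} → adj-sym G {u} {v})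

    root-cong : ∀ {u v} → Star (Adj G) u v → root u ≡ root v
    root-cong = representative-cong (λ {u} {v} → adj-sym G {u} {v})

    -- Every `r` is allowed as an index; the graph is empty unless `r` is the root of a vertex of
    -- `G`.
    component : Fin N → Graph N
    component r = graph (λ v → v ∈ vertices G × root v ≡ r)
      (λ u v → Adj G u v × root u ≡ r)
      (λ (e , eq) → adj-vertex G e , eq)
      (λ (e , eq) → adj-sym G e , ≡.trans (root-cong (adj-sym G e ◅ ε)) eq)
      (λ (e , _) → adj-irrefl G e)

    component⊑ : ∀ r → component r ⊑ G
    component⊑ r = (λ v∈ → proj₁ (⟦⟧⁻ v∈)) , (λ e → proj₁ (bool⁻ e))

    component-root : ∀ {r v} → v ∈ vertices (component r) → root v ≡ r
    component-root v∈ = proj₂ (⟦⟧⁻ v∈)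

    component-vertex : ∀ {v} → v ∈ vertices G → v ∈ vertices (component (root v))
    component-vertex v∈ = ⟦⟧⁺ (v∈ , ≡.refl)

    component-edge : ∀ {u v} → Adj G u v → Adj (component (root u)) u v
    component-edge e = bool⁺ (e , ≡.refl)

    component-connected : ∀ r → Connected (component r)
    component-connected r u v u∈ v∈ = lift (component-root u∈)
      (representative-reflects (λ {u} {v} → adj-sym G {u} {v})
        (≡.trans (component-root u∈) (≡.sym (component-root v∈))))
      where
      lift : ∀ {u} → root u ≡ r → Star (Adj G) u v → Star (Adj (component r)) u v
      lift eq ε        = ε
      lift eq (e ◅ es) = bool⁺ (e , eq) ◅ lift (≡.trans (≡.sym (root-cong (e ◅ ε))) eq) es

  lookup-injective : ∀ {xs : List (Fin N)} → Unique xs → Injective _≡_ _≡_ (lookupᴸ xs)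
  lookup-injective (_ AllPairs.∷ _)  {zero}  {zero}  _  = ≡.refl
  lookup-injective (p AllPairs.∷ _)  {zero}  {suc j} eq = contradiction eq (All.lookup p (∈-lookup j))
  lookup-injective (p AllPairs.∷ _)  {suc i} {zero}  eq = contradiction (≡.sym eq) (All.lookup p (∈-lookup i))
  lookup-injective (_ AllPairs.∷ ps) {suc i} {suc j} eq = cong suc (lookup-injective ps eq)

  -- The components of an acyclic graph are trees inside it. Since trees are nonempty, the list
  -- `roots` keeps only the indices of nonempty components, and its lack of repetitions yields
  -- disjointness.
  forest : ∀ (𝒫 : Graph N → Set) → Acyclic G → (∀ K → K ⊑ G → IsTree K → 𝒫 K) →
           Σ[ q ∈ ℕ ] Σ[ C ∈ (Fin q → Graph N) ]
             (IsDisjointUnion G C × (∀ i → IsTree (C i) × 𝒫 (C i)))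
  forest {N} {G = G} 𝒫 acyclic hereditary =
    length roots , C , ((vertexUnion , edgeUnion) , disjoint) , λ i → tree i , hereditary _ (C⊑G i) (tree i)
    where
    nonempty? = λ r → decide (Nonempty (vertices (component G r)))
    roots : List (Fin N)
    roots = filter nonempty? (allFin N)
    C : Fin (length roots) → Graph N
    C i = component G (lookupᴸ roots i)
    C⊑G : ∀ i → C i ⊑ G
    C⊑G i = component⊑ G (lookupᴸ roots i)
    tree : ∀ i → IsTree (C i)
    tree i = proj₂ (∈-filter⁻ nonempty? {xs = allFin N} (∈-lookup {xs = roots} i))
           , component-connected G _ , acyclic-⊑ (C⊑G i) acyclic
    find : ∀ {v} → v ∈ vertices G → ∃[ i ] root G v ≡ lookupᴸ roots i
    find {v} v∈ = index r∈ , lookup-index r∈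
      where r∈ = ∈-filter⁺ nonempty? (∈-allFin (root G v)) (v , component-vertex G v∈)
    vertexUnion : ∀ v → v ∈ vertices G ⇔ (∃[ i ] v ∈ vertices (C i))
    vertexUnion v = mk⇔
      (λ v∈ → map₂ (λ eq → subst (λ r → v ∈ vertices (component G r)) eq (component-vertex G v∈)) (find v∈))
      (λ (i , v∈) → vertex (C⊑G i) v∈)
    edgeUnion : ∀ u v → Adj G u v ⇔ (∃[ i ] Adj (C i) u v)
    edgeUnion u v = mk⇔
      (λ e → map₂ (λ eq → subst (λ r → Adj (component G r) u v) eq (component-edge G e)) (find (adj-vertex G e)))
      (λ (i , e) → edge (C⊑G i) e)
    disjoint : ∀ i j → i ≢ j → ∀ v → v ∈ vertices (C i) → ¬ v ∈ vertices (C j)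
    disjoint i j i≢j v v∈i v∈j = i≢j (lookup-injective (filter⁺ nonempty? (allFin⁺ N))
      (≡.trans (≡.sym (component-root G v∈i)) (component-root G v∈j)))

-- Arithmetic and distances in a complete ordered field.

module Geometry (em : ExcludedMiddle 0ℓ) (ℝ : Reals) where

  open Classical em
  open Reals ℝ hiding (zero)
  open SumProperties +-commutativeMonoid using (sum; sum-remove; sum-cong-≋; sum-replicate-zero)
  open RingProperties ring using (-‿distribˡ-*; -‿distribʳ-*; -‿involutive)
  open NaturalSolver commutativeSemiring using (solve; _:+_; _:*_; _:=_)
  module ≈-Reasoning = SetoidReasoning setoid
  open IsTotalOrder isTotalOrder public using (antisym; total; ≤-respˡ-≈; ≤-respʳ-≈)
    renaming (refl to ≤-refl; trans to ≤-trans; reflexive to ≤-reflexive)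

  <⇒≤ : ∀ {x y} → x < y → x ≤ y
  <⇒≤ = proj₁

  <-≤-trans : ∀ {x y z} → x < y → y ≤ z → x < z
  <-≤-trans = Strict.<-≤-trans _≈_ _≤_ sym ≤-trans antisym ≤-respʳ-≈

  ≤-<-trans : ∀ {x y z} → x ≤ y → y < z → x < z
  ≤-<-trans = Strict.≤-<-trans _≈_ _≤_ ≤-trans antisym ≤-respˡ-≈

  <-trans : ∀ {x y z} → x < y → y < z → x < z
  <-trans p q = <-≤-trans p (<⇒≤ q)

  <-irrefl : ∀ {x} → ¬ x < x
  <-irrefl (_ , x≉x) = x≉x refl

  <⇒≱ : ∀ {x y} → x < y → ¬ y ≤ x
  <⇒≱ = Strict.<⇒≱ _≈_ _≤_ antisym

  ≰⇒> : ∀ {x y} → ¬ x ≤ y → y < x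
  ≰⇒> = Strict.≰⇒> _≈_ _≤_ sym ≤-reflexive total

  ≮⇒≥ : ∀ {x y} → ¬ x < y → y ≤ x
  ≮⇒≥ {x} {y} x≮y with total y x
  ... | inj₁ y≤x = y≤x
  ... | inj₂ x≤y with decide (x ≈ y)
  ... | yes x≈y = ≤-reflexive (sym x≈y)
  ... | no  x≉y = contradiction (x≤y , x≉y) x≮y

  compare : ∀ x y → x < y ⊎ x ≈ y ⊎ y < x
  compare x y with decide (x ≈ y) | total x y
  ... | yes x≈y | _        = inj₂ (inj₁ x≈y)
  ... | no  x≉y | inj₁ x≤y = inj₁ (x≤y , x≉y)
  ... | no  x≉y | inj₂ y≤x = inj₂ (inj₂ (y≤x , x≉y ∘ sym))

  +-monoˡ-≤ : ∀ x {y z} → y ≤ z → y + x ≤ z + x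
  +-monoˡ-≤ x y≤z = ≤-respˡ-≈ (+-comm x _) (≤-respʳ-≈ (+-comm x _) (+-monoʳ-≤ x y≤z))

  +-cancelˡ : ∀ x {y z} → x + y ≈ x + z → y ≈ z
  +-cancelˡ x {y} {z} eq = trans (sym (cancel y)) (trans (+-congˡ eq) (cancel z))
    where
    cancel : ∀ y → - x + (x + y) ≈ y
    cancel y = trans (sym (+-assoc _ _ _)) (trans (+-congʳ (-‿inverseˡ x)) (+-identityˡ y))

  +-monoʳ-< : ∀ x {y z} → y < z → x + y < x + z
  +-monoʳ-< x (y≤z , y≉z) = +-monoʳ-≤ x y≤z , y≉z ∘ +-cancelˡ x

  +-monoˡ-< : ∀ x {y z} → y < z → y + x < z + x
  +-monoˡ-< x {y} {z} y<z =
    <-≤-trans (≤-<-trans (≤-reflexive (+-comm y x)) (+-monoʳ-< x y<z)) (≤-reflexive (+-comm x z))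

  x<x+y : ∀ x {y} → 0# < y → x < x + y
  x<x+y x 0<y = ≤-<-trans (≤-reflexive (sym (+-identityʳ x))) (+-monoʳ-< x 0<y)

  +-cancelˡ-≤ : ∀ x {y z} → x + y ≤ x + z → y ≤ z
  +-cancelˡ-≤ x x+y≤x+z = ≮⇒≥ (λ z<y → <⇒≱ (+-monoʳ-< x z<y) x+y≤x+z)

  difference : ∀ x y → ∃[ d ] x + d ≈ y
  difference x y = y - x , (begin
    x + (y - x)    ≈⟨ +-congˡ (+-comm y (- x)) ⟩
    x + (- x + y)  ≈⟨ +-assoc x (- x) y ⟨
    (x - x) + y    ≈⟨ +-congʳ (-‿inverseʳ x) ⟩
    0# + y         ≈⟨ +-identityˡ y ⟩
    y ∎)
    where open ≈-Reasoning

  gap : ∀ {x y} → x < y → ∃[ d ] (0# < d × x + d ≈ y)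
  gap {x} {y} x<y with difference x y
  ... | d , x+d≈y = d , ≰⇒> (λ d≤0 → <⇒≱ x<y
        (≤-trans (≤-reflexive (sym x+d≈y))
          (≤-trans (+-monoʳ-≤ x d≤0) (≤-reflexive (+-identityʳ x))))) , x+d≈y

  *-monoʳ-≤ : ∀ {x y z} → 0# ≤ x → y ≤ z → x * y ≤ x * z
  *-monoʳ-≤ {x} {y} {z} 0≤x y≤z with difference y z
  ... | d , y+d≈z = ≤-respʳ-≈ (trans (sym (distribˡ x y d)) (*-congˡ y+d≈z))
        (≤-respˡ-≈ (+-identityʳ (x * y)) (+-monoʳ-≤ (x * y) (*-nonNeg 0≤x 0≤d)))
    where
    0≤d : 0# ≤ d
    0≤d = +-cancelˡ-≤ y (≤-respˡ-≈ (sym (+-identityʳ y)) (≤-respʳ-≈ (sym y+d≈z) y≤z))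

  *-cancelˡ : ∀ {x y z} → ¬ x ≈ 0# → x * y ≈ x * z → y ≈ z
  *-cancelˡ {x} {y} {z} x≉0 eq with inverse x x≉0
  ... | x⁻¹ , xx⁻¹≈1 = trans (sym (cancel y)) (trans (*-congˡ eq) (cancel z))
    where
    cancel : ∀ y → x⁻¹ * (x * y) ≈ y
    cancel y = trans (sym (*-assoc _ _ _))
      (trans (*-congʳ (trans (*-comm x⁻¹ x) xx⁻¹≈1)) (*-identityˡ y))

  square-nonNeg : ∀ x → 0# ≤ x * x
  square-nonNeg x with total 0# x
  ... | inj₁ 0≤x = *-nonNeg 0≤x 0≤x
  ... | inj₂ x≤0 = ≤-respʳ-≈ -x*-x (*-nonNeg 0≤-x 0≤-x)
    where
    0≤-x : 0# ≤ - x
    0≤-x = ≤-respˡ-≈ (-‿inverseˡ x) (≤-respʳ-≈ (+-identityʳ (- x)) (+-monoʳ-≤ (- x) x≤0))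
    -x*-x : - x * - x ≈ x * x
    -x*-x = trans (sym (-‿distribˡ-* x (- x)))
      (trans (-‿cong (sym (-‿distribʳ-* x x))) (-‿involutive (x * x)))

  0<1 : 0# < 1#
  0<1 = ≤-respʳ-≈ (*-identityˡ 1#) (square-nonNeg 1#) , 0≉1

  square-cancel-≤ : ∀ {x r} → 0# < r → x * x ≤ r * r → x ≤ r
  square-cancel-≤ {x} {r} 0<r x²≤r² = ≮⇒≥ λ r<x →
    let 0≤r    = <⇒≤ 0<r
        r²≤rx  = *-monoʳ-≤ 0≤r (<⇒≤ r<x)
        rx≤x²  = ≤-respˡ-≈ (*-comm x r) (*-monoʳ-≤ (≤-trans 0≤r (<⇒≤ r<x)) (<⇒≤ r<x))
        r²≈rx  = antisym r²≤rx (≤-trans rx≤x² x²≤r²)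
    in proj₂ r<x (*-cancelˡ (λ r≈0 → proj₂ 0<r (sym r≈0)) r²≈rx)

  positive-inverse : ∀ {x} → 0# < x → ∃[ y ] (0# < y × x * y ≈ 1#)
  positive-inverse {x} 0<x with inverse x (λ x≈0 → proj₂ 0<x (sym x≈0))
  ... | y , xy≈1 = y , ≰⇒> (λ y≤0 → <⇒≱ 0<1
        (≤-trans (≤-reflexive (sym xy≈1))
          (≤-trans (*-monoʳ-≤ (<⇒≤ 0<x) y≤0) (≤-reflexive (zeroʳ x))))) , xy≈1

  x≤x+1 : ∀ x → x ≤ x + 1#
  x≤x+1 x = <⇒≤ (x<x+y x 0<1)

  0<2 : 0# < 1# + 1#
  0<2 = <-trans 0<1 (x<x+y 1# 0<1)

  half : ∀ {x} → 0# < x → ∃[ h ] (0# < h × h + h ≈ x)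
  half {x} 0<x with positive-inverse 0<2
  ... | ½ , 0<½ , 2*½≈1 = x * ½
      , (*-nonNeg (<⇒≤ 0<x) (<⇒≤ 0<½) , λ 0≈x½ → proj₂ 0<x
          (trans (sym (zeroʳ (1# + 1#))) (trans (*-congˡ 0≈x½) (trans (double x ½) sum-is-x))))
      , sum-is-x
    where
    double : ∀ x h → (1# + 1#) * (x * h) ≈ x * h + x * h
    double x h = trans (distribʳ (x * h) 1# 1#) (+-cong (*-identityˡ _) (*-identityˡ _))
    sum-is-x : x * ½ + x * ½ ≈ x
    sum-is-x = trans (sym (double x ½))
      (trans (solve 3 (λ a b c → a :* (b :* c) := b :* (a :* c)) refl (1# + 1#) x ½)
        (trans (*-congˡ 2*½≈1) (*-identityʳ x)))

  max : ∀ x y → ∃[ z ] (x ≤ z × y ≤ z)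
  max x y with total x y
  ... | inj₁ x≤y = y , x≤y , ≤-refl
  ... | inj₂ y≤x = x , ≤-refl , y≤x

  -- Filter-style quantification: finitely many smallness conditions can be met by one positive
  -- number without writing down a minimum. `EventuallyLarge` is the analogue for large scaling
  -- factors.
  EventuallySmall : Pred Carrier 0ℓ → Set
  EventuallySmall P = ∃[ η ] (0# < η × ∀ {δ} → 0# < δ → δ ≤ η → P δ)

  small-∩ : ∀ {P Q : Pred Carrier 0ℓ} →
            EventuallySmall P → EventuallySmall Q → EventuallySmall (λ δ → P δ × Q δ)
  small-∩ (η , 0<η , p) (η′ , 0<η′ , q) with total η η′
  ... | inj₁ η≤η′ = η , 0<η , λ 0<δ δ≤η → p 0<δ δ≤η , q 0<δ (≤-trans δ≤η η≤η′)
  ... | inj₂ η′≤η = η′ , 0<η′ , λ 0<δ δ≤η′ → p 0<δ (≤-trans δ≤η′ η′≤η) , q 0<δ δ≤η′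

  small-∀ : ∀ {k} {P : Fin k → Pred Carrier 0ℓ} →
            (∀ i → EventuallySmall (P i)) → EventuallySmall (λ δ → ∀ i → P i δ)
  small-∀ {zero}  _ = 1# , 0<1 , λ _ _ ()
  small-∀ {suc k} ev with small-∩ (ev zero) (small-∀ (ev ∘ suc))
  ... | η , 0<η , p = η , 0<η , λ 0<δ δ≤η → λ
    { zero → proj₁ (p 0<δ δ≤η) ; (suc i) → proj₂ (p 0<δ δ≤η) i }

  EventuallyLarge : Pred Carrier 0ℓ → Set
  EventuallyLarge P = ∃[ s ] ∀ {t} → s ≤ t → P t

  large-∀ : ∀ {k} {P : Fin k → Pred Carrier 0ℓ} →
            (∀ i → EventuallyLarge (P i)) → EventuallyLarge (λ t → ∀ i → P i t)
  large-∀ {zero}  _ = 0# , λ _ ()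
  large-∀ {suc k} ev with ev zero | large-∀ (ev ∘ suc)
  ... | s , p | s′ , p′ with max s s′
  ... | m , s≤m , s′≤m = m , λ m≤t → λ
    { zero → p (≤-trans s≤m m≤t) ; (suc i) → p′ (≤-trans s′≤m m≤t) i }

  -- The reach of a disc of radius δ whose centre is displaced by 2δ in each coordinate.
  triple : Carrier → Carrier
  triple δ = δ + (δ + δ)

  small-gap : ∀ x y → EventuallySmall (λ δ → x < y → x + triple δ < y)
  small-gap x y with decide (x < y)
  ... | no x≮y = 1# , 0<1 , λ _ _ x<y → contradiction x<y x≮y
  ... | yes x<y =
    let (d , 0<d , x+d≈y) = gap x<y
        (h , 0<h , 2h≈d)  = half 0<d
        (q , 0<q , 2q≈h)  = half 0<h
    -- A quarter of the gap is small enough: three quarters stay strictly below the whole.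
    in q , 0<q , λ 0<δ δ≤q _ → <-≤-trans
      (+-monoʳ-< x (≤-<-trans (triple-mono δ≤q) (triple< 0<q (trans (+-cong 2q≈h 2q≈h) 2h≈d))))
      (≤-reflexive x+d≈y)
    where
    triple-mono : ∀ {δ q} → δ ≤ q → triple δ ≤ triple q
    triple-mono {δ} {q} le = ≤-trans (+-monoˡ-≤ (δ + δ) le)
      (+-monoʳ-≤ q (≤-trans (+-monoˡ-≤ δ le) (+-monoʳ-≤ q le)))
    triple< : ∀ {q d} → 0# < q → (q + q) + (q + q) ≈ d → triple q < d
    triple< {q} 0<q 4q≈d = <-≤-trans (x<x+y (triple q) 0<q) (≤-reflexive
      (trans (solve 1 (λ q → (q :+ (q :+ q)) :+ q := (q :+ q) :+ (q :+ q)) refl q) 4q≈d))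

  sum-nonNeg : ∀ {k} (f : Fin k → Carrier) → (∀ i → 0# ≤ f i) → 0# ≤ sum f
  sum-nonNeg {zero}  f f≥0 = ≤-refl
  sum-nonNeg {suc k} f f≥0 = ≤-trans (f≥0 zero)
    (≤-respˡ-≈ (+-identityʳ _) (+-monoʳ-≤ (f zero) (sum-nonNeg (f ∘ suc) (f≥0 ∘ suc))))

  ≤-sum : ∀ {k} (f : Fin k → Carrier) → (∀ i → 0# ≤ f i) → ∀ i → f i ≤ sum f
  ≤-sum {suc k} f f≥0 zero =
    ≤-respˡ-≈ (+-identityʳ _) (+-monoʳ-≤ (f zero) (sum-nonNeg (f ∘ suc) (f≥0 ∘ suc)))
  ≤-sum {suc k} f f≥0 (suc i) = ≤-trans (≤-sum (f ∘ suc) (f≥0 ∘ suc) i)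
    (≤-respˡ-≈ (+-identityˡ _) (+-monoˡ-≤ (sum (f ∘ suc)) (f≥0 zero)))

  sum≈0 : ∀ {k} (f : Fin k → Carrier) → (∀ i → f i ≈ 0#) → sum f ≈ 0#
  sum≈0 {k} f f≈0 = trans (sum-cong-≋ f≈0) (sum-replicate-zero k)

  sum-single : ∀ {k} (f : Fin k → Carrier) j → (∀ i → i ≢ j → f i ≈ 0#) → sum f ≈ f j
  sum-single {suc k} f j f≈0 = trans (sum-remove {i = j} f)
    (trans (+-congˡ (sum≈0 _ (λ i → f≈0 (punchIn j i) (punchInᵢ≢i j i)))) (+-identityʳ (f j)))

  module _ {d} (i : Fin d) (x p : Point ℝ d) where

    private
      term : Fin d → Carrier
      term j = if does (j ≟ i) then 0# else (x j - p j) * (x j - p j)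

      term≥0 : ∀ j → 0# ≤ term j
      term≥0 j with j ≟ i
      ... | yes _ = ≤-refl
      ... | no _  = square-nonNeg (x j - p j)

      term≈ : ∀ j → j ≢ i → term j ≈ (x j - p j) * (x j - p j)
      term≈ j j≢i with j ≟ i
      ... | yes j≡i = contradiction j≡i j≢i
      ... | no _    = refl

      term≈0 : ∀ j → (j ≢ i → x j ≈ p j) → term j ≈ 0#
      term≈0 j eq with j ≟ i
      ... | yes _  = refl
      ... | no j≢i = trans (*-congʳ (trans (+-congʳ (eq j≢i)) (-‿inverseʳ (p j)))) (zeroˡ _)

      from-difference : ∀ x y {d} → x - y ≤ d → x ≤ y + d
      from-difference x y x-y≤d = ≤-respˡ-≈ (proj₂ (difference y x)) (+-monoʳ-≤ y x-y≤d)

      flip-square : ∀ a b → (a - b) * (a - b) ≈ (b - a) * (b - a)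
      flip-square a b = begin
        (a - b) * (a - b)      ≈⟨ *-cong -[b-a] -[b-a] ⟨
        - (b - a) * - (b - a)  ≈⟨ -‿distribˡ-* (b - a) _ ⟨
        - ((b - a) * - (b - a)) ≈⟨ -‿cong (-‿distribʳ-* (b - a) _) ⟨
        - - ((b - a) * (b - a)) ≈⟨ -‿involutive _ ⟩
        (b - a) * (b - a) ∎
        where
        open ≈-Reasoning
        -[b-a] : - (b - a) ≈ a - b
        -[b-a] = +-cancelˡ (b - a) (begin
          (b - a) + - (b - a)  ≈⟨ -‿inverseʳ (b - a) ⟩
          0#                   ≈⟨ +-identityˡ 0# ⟨
          0# + 0#              ≈⟨ +-cong (-‿inverseʳ b) (-‿inverseʳ a) ⟨
          (b - b) + (a - a)    ≈⟨ solve 4 (λ b b′ a a′ → (b :+ b′) :+ (a :+ a′) := (b :+ a′) :+ (a :+ b′)) refl b (- b) a (- a) ⟩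
          (b - a) + (a - b)    ∎)

    -- Each squared difference is one term of a sum of nonnegative terms, and it does not change
    -- when the two points are exchanged; this gives both bounds.
    near : ∀ {r} → 0# < r → distance² ℝ i x p ≤ r * r → ∀ j → j ≢ i →
           x j ≤ p j + r × p j ≤ x j + r
    near {r} 0<r dist≤ j j≢i =
      from-difference (x j) (p j) (square-cancel-≤ 0<r square≤) ,
      from-difference (p j) (x j) (square-cancel-≤ 0<r (≤-respˡ-≈ (flip-square (x j) (p j)) square≤))
      where
      square≤ : (x j - p j) * (x j - p j) ≤ r * r
      square≤ = ≤-respˡ-≈ (term≈ j j≢i) (≤-trans (≤-sum term term≥0 j) dist≤)

    distance²-axis : (∀ j → j ≢ i → x j ≈ p j) → distance² ℝ i x p ≈ 0#
    distance²-axis x≈p = sum≈0 term (λ j → term≈0 j (x≈p j))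

    -- Together with `distance²-axis` this supplies all the points at which a given channel is
    -- tested: those on its axis and those on its rim in one coordinate direction.
    distance²-step : ∀ j r → x j ≈ p j + r → (∀ k → k ≢ j → k ≢ i → x k ≈ p k) → j ≢ i →
                     distance² ℝ i x p ≈ r * r
    distance²-step j r xj≈ x≈p j≢i = trans (sum-single term j (λ k k≢j → term≈0 k (x≈p k k≢j)))
      (trans (term≈ j j≢i) (*-cong x-p≈r x-p≈r))
      where
      x-p≈r : x j - p j ≈ r
      x-p≈r = +-cancelˡ (p j) (trans (proj₂ (difference (p j) (x j))) xj≈)

  -- Channels as generic lines of sight.

  HalfOpen Closed : ∀ {m} → Point ℝ m → Point ℝ m → Set
  HalfOpen a p = ∀ k → a k ≤ p k × p k < a k + 1#
  Closed   a p = ∀ k → a k ≤ p k × p k ≤ a k + 1#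

  closed : ∀ {m} {a p : Point ℝ m} → HalfOpen a p → Closed a p
  closed h k = proj₁ (h k) , <⇒≤ (proj₂ (h k))

  -- Half-open boxes make every line of sight generic: moving p slightly in the
  -- positive direction puts it off the boundary of all boxes.
  Sees : ∀ {m N} → Subset N → (Fin N → Point ℝ m) → Rel (Fin N) 0ℓ → Rel (Fin N) 0ℓ
  Sees V a _≺_ u w = ∃[ p ] (HalfOpen (a u) p × HalfOpen (a w) p × u ≺ w ×
    (∀ z → z ∈ V → HalfOpen (a z) p → u ≺ z → z ≺ w → ⊥))

  -- A common setting for panels, where `lo` and `hi` coincide, and cubes, where they differ by one:
  -- each body is a unit box across direction `i` times an interval along it.
  module _ {m N} (i : Fin (suc m)) (a : Fin N → Point ℝ m) (lo hi : Fin N → Carrier)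
           (lo≤hi : ∀ v → lo v ≤ hi v) (S : Fin N → Body ℝ (suc m))
           (S⇔ : ∀ v x → S v x ⇔ (Closed (a v) (λ k → x (punchIn i k)) × lo v ≤ x i × x i ≤ hi v))
           where

    private
      _≺_ : Rel (Fin N) 0ℓ
      u ≺ w = hi u < lo w

      at : Point ℝ m → Carrier → Point ℝ (suc m)
      at p s = insertAt p i s

      at-i : ∀ p s → at p s i ≡ s
      at-i p s = insertAt-lookup p i s

      at-k : ∀ p s k → at p s (punchIn i k) ≡ p k
      at-k p s k = insertAt-punchIn p i s k

      S⁺ : ∀ {v p s} → Closed (a v) p → lo v ≤ s → s ≤ hi v → S v (at p s)
      S⁺ {v} {p} {s} c l h = from (S⇔ v (at p s))
        ((λ k → subst (λ y → a v k ≤ y × y ≤ a v k + 1#) (≡.sym (at-k p s k)) (c k))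
        , subst (lo v ≤_) (≡.sym (at-i p s)) l , subst (_≤ hi v) (≡.sym (at-i p s)) h)

      S⁻ : ∀ {v p s} → S v (at p s) → Closed (a v) p × lo v ≤ s × s ≤ hi v
      S⁻ {v} {p} {s} Svx with to (S⇔ v (at p s)) Svx
      ... | c , l , h = (λ k → subst (λ y → a v k ≤ y × y ≤ a v k + 1#) (at-k p s k) (c k))
        , subst (lo v ≤_) (at-i p s) l , subst (_≤ hi v) (at-i p s) h

    -- Over the common point `p` the bodies are intervals of one line. If neither is below the
    -- other, the larger of their lower ends lies in both.
    disjoint⇒separated : ∀ {u w p} → Disjoint ℝ (S u) (S w) →
      Closed (a u) p → Closed (a w) p → u ≺ w ⊎ w ≺ u
    disjoint⇒separated {u} {w} {p} disj pu pw with decide (u ≺ w) | decide (w ≺ u)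
    ... | yes u≺w | _ = inj₁ u≺w
    ... | _ | yes w≺u = inj₂ w≺u
    ... | no u⊀w | no w⊀u with total (lo u) (lo w)
    ... | inj₁ lu≤lw = ⊥-elim (disj (at p (lo w)) (S⁺ pu lu≤lw (≮⇒≥ u⊀w) , S⁺ pw ≤-refl (lo≤hi w)))
    ... | inj₂ lw≤lu = ⊥-elim (disj (at p (lo u)) (S⁺ pu ≤-refl (lo≤hi u) , S⁺ pw lw≤lu (≮⇒≥ w⊀u)))

    separated⇒disjoint : ∀ {u w} → (∀ p → Closed (a u) p → Closed (a w) p → u ≺ w ⊎ w ≺ u) →
      Disjoint ℝ (S u) (S w)
    separated⇒disjoint {u} {w} sep x (Sux , Swx) with to (S⇔ u x) Sux | to (S⇔ w x) Swx
    ... | pu , lu , hu | pw , lw , hw with sep _ pu pw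
    ... | inj₁ u≺w = <⇒≱ u≺w (≤-trans lw hu)
    ... | inj₂ w≺u = <⇒≱ w≺u (≤-trans lu hw)

    module _ (V : Subset N) (disjoint : ∀ u v → u ∈ V → v ∈ V → u ≢ v → Disjoint ℝ (S u) (S v))
             {u w : Fin N} (u∈V : u ∈ V) (w∈V : w ∈ V) (u≢w : u ≢ w) where

      private
        cover : (j : Fin (suc m)) → j ≢ i → ∃[ k ] punchIn i k ≡ j
        cover j j≢i = punchOut (j≢i ∘ ≡.sym) , punchIn-punchOut (j≢i ∘ ≡.sym)

      -- The axis of the channel is the line of sight. The rim point in each coordinate direction
      -- still lies in the closed box, so the axis is strictly below the upper face; this is the
      -- half-open condition. A body over the axis and between the two heights would meet the
      -- cylinder at its own lower end.
      channel⇒sees : Channel↑ ℝ V S i u w → Sees V a _≺_ u w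
      channel⇒sees (p , r , s , t , 0<r , s≤t , bottom , top , clear) =
        q , halfOpen s ≤-refl s≤t bottom
          , halfOpen t s≤t ≤-refl top , u≺w , unblocked
        where
        q : Point ℝ m
        q k = p (punchIn i k)
        axis : ∀ {h} → s ≤ h → h ≤ t → Cylinder ℝ i p r s t (at q h)
        axis {h} s≤h h≤t =
          ≤-respˡ-≈ (sym (distance²-axis i (at q h) p on-axis)) (square-nonNeg r)
          , subst (s ≤_) (≡.sym (at-i q h)) s≤h , subst (_≤ t) (≡.sym (at-i q h)) h≤t
          where
          on-axis : ∀ j → j ≢ i → at q h j ≈ p j
          on-axis j j≢i with cover j j≢i
          ... | k , ≡.refl = reflexive (at-k q h k)
        rim : ∀ k h → s ≤ h → h ≤ t →
              ∃[ q′ ] (q′ k ≈ q k + r × Cylinder ℝ i p r s t (at q′ h))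
        rim k h s≤h h≤t = q′ , reflexive q′k
          , ≤-reflexive (distance²-step i (at q′ h) p (punchIn i k) r
              (reflexive (≡.trans (at-k q′ h k) q′k)) other (punchInᵢ≢i i k))
          , subst (s ≤_) (≡.sym (at-i q′ h)) s≤h , subst (_≤ t) (≡.sym (at-i q′ h)) h≤t
          where
          q′ : Point ℝ m
          q′ l = if does (l ≟ k) then q l + r else q l
          q′k : q′ k ≡ q k + r
          q′k with k ≟ k
          ... | yes _ = ≡.refl
          ... | no k≢k = contradiction ≡.refl k≢k
          other : ∀ j → j ≢ punchIn i k → j ≢ i → at q′ h j ≈ p j
          other j j≢k j≢i with cover j j≢i
          ... | l , ≡.refl = reflexive (≡.trans (at-k q′ h l) q′l)
            where
            q′l : q′ l ≡ q l
            q′l with l ≟ k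
            ... | yes l≡k = contradiction (cong (punchIn i) l≡k) j≢k
            ... | no _ = ≡.refl
        centre : ∀ {v} h → s ≤ h → h ≤ t →
                 (∀ x → Cylinder ℝ i p r s t x → x i ≈ h → S v x) →
                 Closed (a v) q × lo v ≤ h × h ≤ hi v
        centre h s≤h h≤t inside = S⁻ (inside _ (axis s≤h h≤t) (reflexive (at-i q h)))
        halfOpen : ∀ {v} h → s ≤ h → h ≤ t →
                   (∀ x → Cylinder ℝ i p r s t x → x i ≈ h → S v x) → HalfOpen (a v) q
        halfOpen h s≤h h≤t inside k with rim k h s≤h h≤t
        ... | q′ , q′k≈ , cyl with S⁻ (inside _ cyl (reflexive (at-i q′ h)))
        ... | c′ , _ = proj₁ (proj₁ (centre h s≤h h≤t inside) k)
          , <-≤-trans (x<x+y (q k) 0<r) (≤-respˡ-≈ q′k≈ (proj₂ (c′ k)))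
        q∈u = centre s ≤-refl s≤t bottom
        q∈w = centre t s≤t ≤-refl top
        u≺w : u ≺ w
        u≺w with disjoint⇒separated (disjoint u w u∈V w∈V u≢w) (proj₁ q∈u) (proj₁ q∈w)
        ... | inj₁ u≺w = u≺w
        ... | inj₂ w≺u = contradiction
          (≤-trans (proj₁ (proj₂ q∈u)) (≤-trans s≤t (proj₂ (proj₂ q∈w)))) (<⇒≱ w≺u)
        unblocked : ∀ z → z ∈ V → HalfOpen (a z) q → u ≺ z → z ≺ w → ⊥
        unblocked z z∈V q∈z u≺z z≺w = clear z z∈V
          (λ { ≡.refl → <⇒≱ u≺z (lo≤hi z) }) (λ { ≡.refl → <⇒≱ z≺w (lo≤hi z) })
          (at q (lo z))
          ( axis (≤-trans (proj₂ (proj₂ q∈u)) (<⇒≤ u≺z))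
              (≤-trans (lo≤hi z) (≤-trans (<⇒≤ z≺w) (proj₁ (proj₂ q∈w))))
          , S⁺ (closed q∈z) ≤-refl (lo≤hi z))

      private
        Clearance : Point ℝ m → Carrier → Set
        Clearance q δ = ∀ z k → (q k < a z k → q k + triple δ < a z k) ×
                                (q k < a z k + 1# → q k + triple δ < a z k + 1#)

        clearance : ∀ q → EventuallySmall (Clearance q)
        clearance q = small-∀ λ z → small-∀ λ k →
          small-∩ (small-gap (q k) (a z k)) (small-gap (q k) (a z k + 1#))

        -- The disc has radius δ and is centred 2δ beyond `q` in every coordinate, so its points lie
        -- strictly beyond `q` and at most 3δ away. By `Clearance` no face of a box falls into this
        -- range. Hence a half-open box containing `q` contains the disc, and a closed box meeting
        -- the disc contains `q` in the half-open sense.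
        channel-within : ∀ q δ → 0# < δ → Clearance q δ → HalfOpen (a u) q → HalfOpen (a w) q →
          u ≺ w → (∀ z → z ∈ V → HalfOpen (a z) q → u ≺ z → z ≺ w → ⊥) → Channel↑ ℝ V S i u w
        channel-within q δ 0<δ small q∈u q∈w u≺w unblocked =
          -- The coordinate `0#` in direction `i` is arbitrary, since the distance ignores it. The
          -- channel runs exactly from the top of `u` to the bottom of `w`.
          at q⁺ 0# , δ , hi u , lo w , 0<δ , <⇒≤ u≺w
          , (λ x cyl x≈ → from (S⇔ u x) (inside u x q∈u cyl , ≤-respʳ-≈ (sym x≈) (lo≤hi u) , ≤-reflexive x≈))
          , (λ x cyl x≈ → from (S⇔ w x) (inside w x q∈w cyl , ≤-reflexive (sym x≈) , ≤-respˡ-≈ (sym x≈) (lo≤hi w)))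
          , clear
          where
          q⁺ : Point ℝ m
          q⁺ k = q k + (δ + δ)
          within : ∀ x → Cylinder ℝ i (at q⁺ 0#) δ (hi u) (lo w) x →
                   ∀ k → q k < x (punchIn i k) × x (punchIn i k) ≤ q k + triple δ
          within x (dist≤ , _) k with near i x (at q⁺ 0#) 0<δ dist≤ (punchIn i k) (punchInᵢ≢i i k)
          ... | x≤ , ≤x rewrite at-k q⁺ 0# k =
            <-≤-trans (x<x+y (q k) 0<δ) (+-cancelˡ-≤ δ (≤-respˡ-≈
              (solve 2 (λ q δ → q :+ (δ :+ δ) := δ :+ (q :+ δ)) refl (q k) δ)
              (≤-respʳ-≈ (+-comm _ δ) ≤x)))
            , ≤-respʳ-≈ (solve 2 (λ q δ → (q :+ (δ :+ δ)) :+ δ := q :+ (δ :+ (δ :+ δ))) refl (q k) δ) x≤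
          inside : ∀ v x → HalfOpen (a v) q → Cylinder ℝ i (at q⁺ 0#) δ (hi u) (lo w) x →
                   Closed (a v) (λ k → x (punchIn i k))
          inside v x q∈v cyl k with within x cyl k
          ... | q<x , x≤ = ≤-trans (proj₁ (q∈v k)) (<⇒≤ q<x)
            , ≤-trans x≤ (<⇒≤ (proj₂ (small v k) (proj₂ (q∈v k))))
          clear : ∀ z → z ∈ V → z ≢ u → z ≢ w →
                  Disjoint ℝ (Cylinder ℝ i (at q⁺ 0#) δ (hi u) (lo w)) (S z)
          clear z z∈V z≢u z≢w x (cyl , Szx) with to (S⇔ z x) Szx
          ... | x∈z , lz , hz = unblocked z z∈V q∈z u≺z z≺w
            where
            q∈z : HalfOpen (a z) q
            q∈z k with within x cyl k
            ... | q<x , x≤ =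
              ≮⇒≥ (λ q<a → <⇒≱ (proj₁ (small z k) q<a) (≤-trans (proj₁ (x∈z k)) x≤))
              , <-≤-trans q<x (proj₂ (x∈z k))
            u≺z : u ≺ z
            u≺z with disjoint⇒separated (disjoint u z u∈V z∈V (z≢u ∘ ≡.sym)) (closed q∈u) (closed q∈z)
            ... | inj₁ u≺z = u≺z
            ... | inj₂ z≺u = contradiction
              (≤-trans (lo≤hi u) (≤-trans (proj₁ (proj₂ cyl)) hz)) (<⇒≱ z≺u)
            z≺w : z ≺ w
            z≺w with disjoint⇒separated (disjoint z w z∈V w∈V z≢w) (closed q∈z) (closed q∈w)
            ... | inj₁ z≺w = z≺w
            ... | inj₂ w≺z = contradiction
              (≤-trans lz (≤-trans (proj₂ (proj₂ cyl)) (lo≤hi w))) (<⇒≱ w≺z)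

      sees⇒channel : Sees V a _≺_ u w → Channel↑ ℝ V S i u w
      sees⇒channel (q , q∈u , q∈w , u≺w , unblocked) =
        let (δ , 0<δ , small) = clearance q
        in channel-within q δ 0<δ (small 0<δ ≤-refl) q∈u q∈w u≺w unblocked

    channel⇔sees : ∀ V → (∀ u v → u ∈ V → v ∈ V → u ≢ v → Disjoint ℝ (S u) (S v)) →
                   ∀ {u w} → u ∈ V → w ∈ V → u ≢ w →
                   Channel ℝ V S i u w ⇔ (Sees V a _≺_ u w ⊎ Sees V a _≺_ w u)
    channel⇔sees V disjoint u∈V w∈V u≢w = mk⇔
      (Sum.map (channel⇒sees V disjoint u∈V w∈V u≢w) (channel⇒sees V disjoint w∈V u∈V (u≢w ∘ ≡.sym)))
      (Sum.map (sees⇒channel V disjoint u∈V w∈V u≢w) (sees⇒channel V disjoint w∈V u∈V (u≢w ∘ ≡.sym)))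

-- Reconciles the coordinates of `Panel`, whose degenerate direction is last, with those of the
-- direction-independent description of channels.
punchIn-fromℕ : ∀ {m} (k : Fin m) → punchIn (fromℕ m) k ≡ inject₁ k
punchIn-fromℕ zero    = ≡.refl
punchIn-fromℕ (suc k) = cong suc (punchIn-fromℕ k)

-- Panel layouts and their restriction to connected subgraphs.

module Panels (em : ExcludedMiddle 0ℓ) (ℝ : Reals) where
  open Classical em
  open Geometry em ℝ
  open Reals ℝ hiding (zero)

  -- Orthogonal visibility without channels. Closed boxes express that the panels are disjoint,
  -- half-open boxes that they see each other. Base and height are total, but constrained only on
  -- the vertices of `G`.
  record PanelLayout (m : ℕ) (G : Graph N) : Set where
    field
      base      : Fin N → Point ℝ m
      height    : Fin N → Carrier
      separated : ∀ {u w} → u ∈ vertices G → w ∈ vertices G → u ≢ w →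
                  ∀ p → Closed (base u) p → Closed (base w) p → ¬ height u ≈ height w
      visible   : ∀ {u w} → u ∈ vertices G → w ∈ vertices G → u ≢ w →
                  Adj G u w ⇔ (Sees (vertices G) base (_<_ on height) u w ⊎
                               Sees (vertices G) base (_<_ on height) w u)

  module _ {m} (a : Fin N → Point ℝ m) (c : Fin N → Carrier) where

    panel⇔ : ∀ v x → Panel ℝ (a v) (c v) x ⇔
             (Closed (a v) (λ k → x (punchIn (fromℕ m) k)) × c v ≤ x (fromℕ m) × x (fromℕ m) ≤ c v)
    panel⇔ v x = mk⇔
      (λ (inside , x≈c) →
        (λ k → subst (λ j → a v k ≤ x j × x j ≤ a v k + 1#) (≡.sym (punchIn-fromℕ k)) (inside k))
        , ≤-reflexive (sym x≈c) , ≤-reflexive x≈c)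
      (λ (inside , c≤x , x≤c) →
        (λ k → subst (λ j → a v k ≤ x j × x j ≤ a v k + 1#) (punchIn-fromℕ k) (inside k))
        , antisym x≤c c≤x)

    panel-channel⇔sees : (V : Subset N) →
      (∀ u v → u ∈ V → v ∈ V → u ≢ v → Disjoint ℝ (Panel ℝ (a u) (c u)) (Panel ℝ (a v) (c v))) →
      ∀ {u w} → u ∈ V → w ∈ V → u ≢ w →
      Channel ℝ V (λ v → Panel ℝ (a v) (c v)) (fromℕ m) u w ⇔
      (Sees V a (_<_ on c) u w ⊎ Sees V a (_<_ on c) w u)
    panel-channel⇔sees V = channel⇔sees (fromℕ m) a c c (λ _ → ≤-refl) _ panel⇔ V

  orthogonal⇔panels : ∀ {m} {G : Graph N} → CubeOrthogonalVisibility ℝ m G ⇔ PanelLayout m G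
  orthogonal⇔panels {m = m} {G = G} = mk⇔ ⇒ ⇐
    where
    ⇒ : CubeOrthogonalVisibility ℝ m G → PanelLayout m G
    ⇒ (a , c , disjoint , adj⇔) = record
      { base = a
      ; height = c
      ; separated = λ u∈ w∈ u≢w p pu pw cu≈cw →
          [ (λ u<w → proj₂ u<w cu≈cw) , (λ w<u → proj₂ w<u (sym cu≈cw)) ]
          (disjoint⇒separated (fromℕ m) a c c (λ _ → ≤-refl) _ (panel⇔ a c)
            (disjoint _ _ u∈ w∈ u≢w) pu pw)
      ; visible = λ u∈ w∈ u≢w →
          let channel = panel-channel⇔sees a c (vertices G) disjoint u∈ w∈ u≢w
          in mk⇔
            (λ e → case-last (to (adj⇔ _ _ u∈ w∈ u≢w) e) (to channel))
            (λ s → from (adj⇔ _ _ u∈ w∈ u≢w) (fromℕ m , ≡.refl , from channel s))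
      }
      where
      case-last : ∀ {A : Fin (suc m) → Set} {B : Set} →
                  ∃[ i ] (i ≡ fromℕ m × A i) → (A (fromℕ m) → B) → B
      case-last (_ , ≡.refl , x) f = f x
    ⇐ : PanelLayout m G → CubeOrthogonalVisibility ℝ m G
    ⇐ layout = base , height , disjoint , λ u w u∈ w∈ u≢w →
      let channel = panel-channel⇔sees base height (vertices G) disjoint u∈ w∈ u≢w
      in mk⇔
        (λ e → fromℕ m , ≡.refl , from channel (to (visible u∈ w∈ u≢w) e))
        (λ { (_ , ≡.refl , s) → from (visible u∈ w∈ u≢w) (to channel s) })
      where
      open PanelLayout layout
      disjoint : ∀ u v → u ∈ vertices G → v ∈ vertices G → u ≢ v →
                 Disjoint ℝ (Panel ℝ (base u) (height u)) (Panel ℝ (base v) (height v))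
      disjoint u v u∈ v∈ u≢v = separated⇒disjoint (fromℕ m) base height height (λ _ → ≤-refl) _
        (panel⇔ base height) λ p pu pv → order (compare (height u) (height v)) (separated u∈ v∈ u≢v p pu pv)
        where
        order : ∀ {x y} → x < y ⊎ x ≈ y ⊎ y < x → ¬ x ≈ y → x < y ⊎ y < x
        order (inj₁ x<y) _ = inj₁ x<y
        order (inj₂ (inj₁ x≈y)) x≉y = contradiction x≈y x≉y
        order (inj₂ (inj₂ y<x)) _ = inj₂ y<x

  module _ {m} (acyclic : Acyclic G) (K⊑G : K ⊑ G) (connected : Connected K)
           (layout : PanelLayout m G) where

    open PanelLayout layout

    private
      module _ {u w p} (u∈K : u ∈ vertices K) (w∈K : w ∈ vertices K)
               (p∈u : HalfOpen (base u) p) (p∈w : HalfOpen (base w) p)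
               (clear : ∀ z → z ∈ vertices K → HalfOpen (base z) p →
                        height u < height z → height z < height w → ⊥) where

        OnLine : Fin _ → Set
        OnLine z = z ∈ vertices G × HalfOpen (base z) p × height u ≤ height z × height z ≤ height w

        -- An edge between consecutive panels on the line through `p`. Strictly between `u` and `w`
        -- the line meets no panel of `K` by `clear`, and a panel over `p` at the height of an end
        -- is that end by `separated`.
        Link : Rel (Fin _) 0ℓ
        Link x y = Adj G x y × (x ∈ vertices K → x ≡ u) × (y ∈ vertices K → y ≡ w)

        link : ∀ {x y} → OnLine x → OnLine y → height x < height y →
               (∀ z → z ∈ vertices G → HalfOpen (base z) p →
                height x < height z → height z < height y → ⊥) → Link x y
        link {x} {y} (x∈G , p∈x , u≤x , x≤w) (y∈G , p∈y , u≤y , y≤w) x<y empty =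
          from (visible x∈G y∈G (λ { ≡.refl → <-irrefl x<y })) (inj₁ (p , p∈x , p∈y , x<y , empty))
          , at-u , at-w
          where
          at-u : x ∈ vertices K → x ≡ u
          at-u x∈K with x ≟ u | compare (height u) (height x)
          ... | yes x≡u | _ = x≡u
          ... | no x≢u | inj₁ u<x = contradiction (<-≤-trans x<y y≤w) (clear x x∈K p∈x u<x)
          ... | no x≢u | inj₂ (inj₁ u≈x) = contradiction u≈x
            (separated (vertex K⊑G u∈K) x∈G (x≢u ∘ ≡.sym) p (closed p∈u) (closed p∈x))
          ... | no x≢u | inj₂ (inj₂ x<u) = contradiction u≤x (<⇒≱ x<u)
          at-w : y ∈ vertices K → y ≡ w
          at-w y∈K with y ≟ w | compare (height y) (height w)
          ... | yes y≡w | _ = y≡w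
          ... | no y≢w | inj₁ y<w = contradiction y<w (clear y y∈K p∈y (≤-<-trans u≤x x<y))
          ... | no y≢w | inj₂ (inj₁ y≈w) = contradiction y≈w
            (separated y∈G (vertex K⊑G w∈K) y≢w p (closed p∈y) (closed p∈w))
          ... | no y≢w | inj₂ (inj₂ w<y) = contradiction y≤w (<⇒≱ w<y)

        Between : Fin _ → Fin _ → Fin _ → Set
        Between x y z = z ∈ vertices G × HalfOpen (base z) p × height x < height z × height z < height y

        -- The number `k` bounds the indices of the vertices between `x` and `y`. If the vertex of
        -- index `k` is among them, the chain is split there and both halves have bound `k`; at
        -- bound zero the two panels are consecutive.
        chain : ∀ k {x y} → OnLine x → OnLine y → height x < height y →
                (∀ z → Between x y z → toℕ z ℕ.< k) → Star Link x y
        chain zero x∈ y∈ x<y bound =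
          link x∈ y∈ x<y (λ z z∈ p∈z x<z z<y → ℕₚ.n≮0 (bound z (z∈ , p∈z , x<z , z<y))) ◅ ε
        chain (suc k) {x} {y} x∈@(_ , _ , u≤x , _) y∈@(_ , _ , _ , y≤w) x<y bound
          with decide (∃[ z ] (toℕ z ≡ k × Between x y z))
        ... | no ∄z = chain k x∈ y∈ x<y λ z btw →
          ℕₚ.≤∧≢⇒< (ℕ.s≤s⁻¹ (bound z btw)) (λ z≡k → ∄z (z , z≡k , btw))
        ... | yes (z , z≡k , z∈G , p∈z , x<z , z<y) =
          chain k x∈ z∈ x<z (λ v (v∈ , p∈v , x<v , v<z) →
            smaller v (v∈ , p∈v , x<v , <-trans v<z z<y) (λ { ≡.refl → <-irrefl v<z }))
          ◅◅ chain k z∈ y∈ z<y (λ v (v∈ , p∈v , z<v , v<y) →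
            smaller v (v∈ , p∈v , <-trans x<z z<v , v<y) (λ { ≡.refl → <-irrefl z<v }))
          where
          z∈ : OnLine z
          z∈ = z∈G , p∈z , ≤-trans u≤x (<⇒≤ x<z) , ≤-trans (<⇒≤ z<y) y≤w
          smaller : ∀ v → Between x y v → v ≢ z → toℕ v ℕ.< k
          smaller v btw v≢z = ℕₚ.≤∧≢⇒< (ℕ.s≤s⁻¹ (bound v btw))
            (λ v≡k → v≢z (toℕ-injective (≡.trans v≡k (≡.sym z≡k))))

        -- By `meet`, the walk in `K` and the chain share a walk from `u` to `w`. Its first edge
        -- belongs to `K`, so its far end does too, and `Link` identifies that end with `w`.
        sees⇒adjacent : height u < height w → Adj K u w
        sees⇒adjacent u<w with meet {G = G} acyclic (λ e → edge K⊑G e) proj₁ (connected u w u∈K w∈K)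
            (chain _ (vertex K⊑G u∈K , p∈u , ≤-refl , <⇒≤ u<w)
              (vertex K⊑G w∈K , p∈w , <⇒≤ u<w , ≤-refl) u<w (λ z _ → toℕ<n z))
        ... | ε = contradiction u<w <-irrefl
        ... | (e , _ , _ , at-w) ◅ _ with at-w (adj-vertex K (adj-sym K e))
        ... | ≡.refl = e

    -- A line of sight in the smaller layout that is blocked in the larger one
    -- yields a walk outside K between vertices of K, which acyclicity forbids.
    panels-⊑ : PanelLayout m K
    panels-⊑ = record
      { base = base
      ; height = height
      ; separated = λ u∈ w∈ → separated (vertex K⊑G u∈) (vertex K⊑G w∈)
      ; visible = λ u∈ w∈ u≢w → mk⇔
          (λ e → Sum.map weaken weaken (to (visible (vertex K⊑G u∈) (vertex K⊑G w∈) u≢w) (edge K⊑G e)))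
          [ adjacent u∈ w∈ , (λ s → adj-sym K (adjacent w∈ u∈ s)) ]
      }
      where
      weaken : ∀ {u w} → Sees (vertices G) base (_<_ on height) u w →
               Sees (vertices K) base (_<_ on height) u w
      weaken (p , p∈u , p∈w , u<w , clear) =
        p , p∈u , p∈w , u<w , λ z z∈K → clear z (vertex K⊑G z∈K)
      adjacent : ∀ {u w} → u ∈ vertices K → w ∈ vertices K →
                 Sees (vertices K) base (_<_ on height) u w → Adj K u w
      adjacent u∈ w∈ (p , p∈u , p∈w , u<w , clear) = sees⇒adjacent u∈ w∈ p∈u p∈w clear u<w

  empty-panels : ∀ {m} {G : Graph N} → ¬ Nonempty (vertices G) → PanelLayout m G
  empty-panels empty = record
    { base = λ _ _ → 0# ; height = λ _ → 0#
    ; separated = λ u∈ → contradiction (_ , u∈) empty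
    ; visible = λ u∈ → contradiction (_ , u∈) empty
    }

  OrthogonalForest CubeForest : ℕ → Graph N → Set
  OrthogonalForest m G = ForestOf (CubeOrthogonalVisibility ℝ m) G
  CubeForest n G = ForestOf (CubeVisibility ℝ n) G

  forest-panels : ∀ {m} → OrthogonalForest m H → K ⊑ H → Connected K → PanelLayout m K
  forest-panels {H = H} {K} (q , C , union , trees) K⊑H connected with decide (Nonempty (vertices K))
  ... | no empty = empty-panels empty
  ... | yes (x , x∈K) with to (proj₁ (proj₁ union) x) (vertex K⊑H x∈K)
  ... | i , x∈C = panels-⊑ {G = C i} {K = K} (proj₂ (proj₂ (proj₁ (trees i))))
    (component-⊑ {H = H} {K = K} {C = C} union K⊑H connected x∈K x∈C) connected
    (to (orthogonal⇔panels {G = C i}) (proj₂ (trees i)))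

  -- Together with `forest-panels` this gives a working criterion: an acyclic graph is an orthogonal
  -- visibility forest exactly when all its connected subgraphs have panel layouts.
  orthogonalForest : ∀ {m} → Acyclic G →
    (∀ K → K ⊑ G → Connected K → PanelLayout m K) → OrthogonalForest m G
  orthogonalForest {G = G} {m} acyclic panels = forest {G = G} (CubeOrthogonalVisibility ℝ m) acyclic
    λ K K⊑G (_ , connected , _) → from (orthogonal⇔panels {G = K}) (panels K K⊑G connected)

  orthogonalForest-⊑ : ∀ {m} → Acyclic G → G ⊑ H → OrthogonalForest m H → OrthogonalForest m G
  orthogonalForest-⊑ {G = G} {H} acyclic G⊑H F = orthogonalForest {G = G} acyclic
    λ K K⊑G → forest-panels {H = H} {K = K} F (⊑-trans {K = K} {G} {H} K⊑G G⊑H)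

  ⋃ : ∀ {k} → (Fin k → Graph N) → Graph N
  ⋃ H = graph (λ v → ∃[ i ] v ∈ vertices (H i)) (λ u v → ∃[ i ] Adj (H i) u v)
    (λ (i , e) → i , adj-vertex (H i) e) (λ (i , e) → i , adj-sym (H i) e)
    (λ (i , e) → adj-irrefl (H i) e)

  ⋃-isUnion : ∀ {k} (H : Fin k → Graph N) → IsUnion (⋃ H) H
  ⋃-isUnion H = (λ v → mk⇔ ⟦⟧⁻ ⟦⟧⁺) , (λ u v → mk⇔ bool⁻ bool⁺)

  -- Splitting cube visibility by direction.

  module _ {m} (a : Fin N → Point ℝ (suc m)) where

    side : Fin (suc m) → Fin N → Point ℝ m
    side i v k = a v (punchIn i k)

    Above : Fin (suc m) → Rel (Fin N) 0ℓ
    Above i u w = a u i + 1# < a w i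

    above-asym : ∀ i {u w} → Above i u w → ¬ Above i w u
    above-asym i {u} {w} u<w w<u = <-irrefl
      (<-trans (≤-<-trans (x≤x+1 (a u i)) u<w) (≤-<-trans (x≤x+1 (a w i)) w<u))

    cube⇔ : ∀ i v x → Cube ℝ (a v) x ⇔
            (Closed (side i v) (λ k → x (punchIn i k)) × a v i ≤ x i × x i ≤ a v i + 1#)
    cube⇔ i v x = mk⇔ (λ inside → (λ k → inside (punchIn i k)) , inside i) ⇐
      where
      ⇐ : _ → Cube ℝ (a v) x
      ⇐ (inside , at-i) j with i ≟ j
      ... | yes ≡.refl = at-i
      ... | no i≢j = subst (λ j → a v j ≤ x j × x j ≤ a v j + 1#) (punchIn-punchOut i≢j) (inside (punchOut i≢j))

    cube-channel⇔sees : ∀ i (V : Subset N) →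
      (∀ u v → u ∈ V → v ∈ V → u ≢ v → Disjoint ℝ (Cube ℝ (a u)) (Cube ℝ (a v))) →
      ∀ {u w} → u ∈ V → w ∈ V → u ≢ w →
      Channel ℝ V (λ v → Cube ℝ (a v)) i u w ⇔
      (Sees V (side i) (Above i) u w ⊎ Sees V (side i) (Above i) w u)
    cube-channel⇔sees i V =
      channel⇔sees i (side i) (λ v → a v i) (λ v → a v i + 1#) (λ v → x≤x+1 (a v i)) _ (cube⇔ i) V

    cubes-separated : ∀ i {u w p} → Disjoint ℝ (Cube ℝ (a u)) (Cube ℝ (a w)) →
      Closed (side i u) p → Closed (side i w) p → Above i u w ⊎ Above i w u
    cubes-separated i = disjoint⇒separated i (side i) (λ v → a v i) (λ v → a v i + 1#)
      (λ v → x≤x+1 (a v i)) _ (cube⇔ i)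

  -- All vertices of `G` are kept, so that no blocking cube is lost.
  direction : ∀ {n} {G : Graph N} → CubeVisibility ℝ n G → Fin n → Graph N
  direction {G = G} (a , _) i = graph (_∈ vertices G)
    (λ u w → u ∈ vertices G × w ∈ vertices G × u ≢ w × Channel ℝ (vertices G) (λ v → Cube ℝ (a v)) i u w)
    proj₁ (λ (u∈ , w∈ , u≢w , ch) → w∈ , u∈ , u≢w ∘ ≡.sym , Sum.swap ch)
    (λ (_ , _ , v≢v , _) → v≢v ≡.refl)

  direction-channel : ∀ {n} {G : Graph N} (cubes : CubeVisibility ℝ n G) i {u w} →
    Adj (direction {G = G} cubes i) u w →
    u ∈ vertices G × w ∈ vertices G × u ≢ w × Channel ℝ (vertices G) (λ v → Cube ℝ (proj₁ cubes v)) i u w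
  direction-channel cubes i e = bool⁻ e

  direction⊑ : ∀ {n} {G : Graph N} (cubes : CubeVisibility ℝ n G) i → direction {G = G} cubes i ⊑ G
  direction⊑ {G = G} cubes@(_ , _ , adj⇔) i = ⟦⟧⁻ , λ e → let (u∈ , w∈ , u≢w , ch) = direction-channel {G = G} cubes i e in
    from (adj⇔ _ _ u∈ w∈ u≢w) (i , _ , ch)

  -- Each cube is collapsed to its lower face in direction `i`. Disjoint cubes over a common point
  -- are more than one unit apart in that direction, so comparing lower faces agrees with comparing
  -- whole cubes and the lines of sight are unchanged.
  direction-panels : ∀ {m} {G : Graph N} (cubes : CubeVisibility ℝ (suc m) G) i →
                     PanelLayout m (direction {G = G} cubes i)
  direction-panels {N = N} {m} {G} cubes@(a , disjoint , adj⇔) i = record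
    { base = side a i
    ; height = height
    ; separated = λ u∈ w∈ u≢w p pu pw eq →
        [ (λ u<w → proj₂ (above⇒< u<w) eq) , (λ w<u → proj₂ (above⇒< w<u) (sym eq)) ]
        (cubes-separated a i (disjoint _ _ (⟦⟧⁻ u∈) (⟦⟧⁻ w∈) u≢w) pu pw)
    ; visible = λ u∈ w∈ u≢w →
        let channel = cube-channel⇔sees a i (vertices G) disjoint (⟦⟧⁻ u∈) (⟦⟧⁻ w∈) u≢w
        in mk⇔
          (λ e → let (_ , _ , _ , ch) = direction-channel {G = G} cubes i e in
            Sum.map (lower (⟦⟧⁻ u∈) (⟦⟧⁻ w∈)) (lower (⟦⟧⁻ w∈) (⟦⟧⁻ u∈)) (to channel ch))
          (λ s → bool⁺ (⟦⟧⁻ u∈ , ⟦⟧⁻ w∈ , u≢w ,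
            from channel (Sum.map (raise (⟦⟧⁻ u∈) (⟦⟧⁻ w∈)) (raise (⟦⟧⁻ w∈) (⟦⟧⁻ u∈)) s)))
    }
    where
    height : Fin N → Carrier
    height v = a v i
    above⇒< : ∀ {u w} → Above a i u w → height u < height w
    above⇒< {u} u<w = ≤-<-trans (x≤x+1 (height u)) u<w
    <⇒above : ∀ {u w p} → u ∈ vertices G → w ∈ vertices G →
              HalfOpen (side a i u) p → HalfOpen (side a i w) p → height u < height w → Above a i u w
    <⇒above u∈ w∈ p∈u p∈w u<w with cubes-separated a i
        (disjoint _ _ u∈ w∈ (λ { ≡.refl → <-irrefl u<w })) (closed p∈u) (closed p∈w)
    ... | inj₁ above = above
    ... | inj₂ below = contradiction (<⇒≤ u<w) (<⇒≱ (above⇒< below))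
    lower : ∀ {u w} → u ∈ vertices G → w ∈ vertices G → Sees (vertices G) (side a i) (Above a i) u w →
            Sees ⟦ _∈ vertices G ⟧ (side a i) (_<_ on height) u w
    lower u∈ w∈ (p , p∈u , p∈w , u<w , clear) = p , p∈u , p∈w , above⇒< u<w , λ z z∈ p∈z u<z z<w →
      clear z (⟦⟧⁻ z∈) p∈z (<⇒above u∈ (⟦⟧⁻ z∈) p∈u p∈z u<z) (<⇒above (⟦⟧⁻ z∈) w∈ p∈z p∈w z<w)
    raise : ∀ {u w} → u ∈ vertices G → w ∈ vertices G → Sees ⟦ _∈ vertices G ⟧ (side a i) (_<_ on height) u w →
            Sees (vertices G) (side a i) (Above a i) u w
    raise u∈ w∈ (p , p∈u , p∈w , u<w , clear) = p , p∈u , p∈w , <⇒above u∈ w∈ p∈u p∈w u<w ,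
      λ z z∈ p∈z u<z z<w → clear z (⟦⟧⁺ z∈) p∈z (above⇒< u<z) (above⇒< z<w)

  -- `D i` collects the edges seen in direction `i` in any of the trees. A connected subgraph of it
  -- stays inside one tree `C j`, since the vertex sets of the trees are disjoint, so the layout of
  -- that tree in direction `i` restricts to it.
  cubeForest⇒orthogonalForests : ∀ {m} {H : Graph N} → Acyclic H → CubeForest (suc m) H →
    Σ[ D ∈ (Fin (suc m) → Graph N) ] (IsUnion H D × (∀ i → OrthogonalForest m (D i)))
  cubeForest⇒orthogonalForests {N = N} {m} {H} acyclic (q , C , union@((vertexUnion , edgeUnion) , disjoint) , trees) =
    -- Each `D i` contains every vertex of `H`, so the index `zero` serves for all of them.
    D , ((λ v → mk⇔ (λ v∈ → zero , ⟦⟧⁺ (let (j , v∈C) = to (vertexUnion v) v∈ in j , ⟦⟧⁺ v∈C))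
                     (λ (i , v∈) → vertex (D⊑H i) v∈))
        , (λ u v → mk⇔ (split u v) (λ (i , e) → edge (D⊑H i) e)))
      , λ i → orthogonalForest {G = D i} (acyclic-⊑ {H = D i} (D⊑H i) acyclic) (λ K K⊑D connected → panels i {K} K⊑D connected)
    where
    cubes : ∀ j → CubeVisibility ℝ (suc m) (C j)
    cubes j = proj₂ (trees j)
    D : Fin (suc m) → Graph N
    D i = ⋃ (λ j → direction {G = C j} (cubes j) i)
    D⊑H : ∀ i → D i ⊑ H
    D⊑H i = (λ v∈ → let (j , v∈j) = ⟦⟧⁻ v∈ in from (vertexUnion _) (j , ⟦⟧⁻ v∈j))
      , λ e → let (j , e′) = bool⁻ e in from (edgeUnion _ _) (j , edge (direction⊑ {G = C j} (cubes j) i) e′)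
    split : ∀ u v → Adj H u v → ∃[ i ] Adj (D i) u v
    split u v e =
      let (j , e′)     = to (edgeUnion u v) e
          u∈           = adj-vertex (C j) e′
          v∈           = adj-vertex (C j) (adj-sym (C j) e′)
          u≢v          = λ { ≡.refl → adj-irrefl (C j) e′ }
          (i , _ , ch) = to (proj₂ (proj₂ (cubes j)) u v u∈ v∈ u≢v) e′
      in i , bool⁺ (j , bool⁺ (u∈ , v∈ , u≢v , ch))
    module _ i {K} (K⊑D : K ⊑ D i) (connected : Connected K) where
      K⊑H : K ⊑ H
      K⊑H = ⊑-trans {K = K} {D i} {H} K⊑D (D⊑H i)
      module _ j {x} (x∈K : x ∈ vertices K) (x∈C : x ∈ vertices (C j)) where
        K⊑C : K ⊑ C j
        K⊑C = component-⊑ {H = H} {K = K} {C = C} union K⊑H connected {i = j} x∈K x∈C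
        edges : ∀ {u v} → Adj K u v → Adj (direction {G = C j} (cubes j) i) u v
        edges {u} e with bool⁻ (edge K⊑D e)
        ... | j′ , e′ with j′ ≟ j
        ... | yes ≡.refl = e′
        ... | no j′≢j = contradiction (vertex K⊑C (adj-vertex K e))
          (disjoint j′ j j′≢j u (⟦⟧⁻ (adj-vertex (direction {G = C j′} (cubes j′) i) e′)))
        component-panels : PanelLayout m K
        component-panels = panels-⊑ {G = direction {G = C j} (cubes j) i} {K = K}
          (acyclic-⊑ {H = direction {G = C j} (cubes j) i} (direction⊑ {G = C j} (cubes j) i) (proj₂ (proj₂ (proj₁ (trees j)))))
          ((λ v∈ → ⟦⟧⁺ (vertex K⊑C v∈)) , edges) connected (direction-panels {G = C j} (cubes j) i)
      panels : PanelLayout m K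
      panels with decide (Nonempty (vertices K))
      ... | no empty = empty-panels empty
      ... | yes (x , x∈K) =
         let (j , x∈C) = to (vertexUnion x) (vertex K⊑H x∈K) in component-panels j x∈K x∈C

-- Separating cubes within a single coordinate.

module Stretch (em : ExcludedMiddle 0ℓ) (ℝ : Reals) where
  open Classical em
  open Geometry em ℝ
  open Reals ℝ hiding (zero)
  open SumProperties +-commutativeMonoid using (sum; sum-remove; sum-cong-≋)
  open RingProperties ring using (-‿+-comm)
  open NaturalSolver commutativeSemiring using (solve; _:+_; _:*_; _:=_)

  sum-swap : ∀ {k} (f g : Fin k → Carrier) i → (∀ j → j ≢ i → f j ≈ g j) →
             sum f - sum g ≈ f i - g i
  sum-swap {suc k} f g i f≈g = begin
    sum f - sum g                      ≈⟨ +-cong (sum-remove {i = i} f) (-‿cong (sum-remove {i = i} g)) ⟩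
    (f i + _) - (g i + _)              ≈⟨ +-congˡ (-‿+-comm _ _) ⟨
    (f i + _) + (- g i + - _)          ≈⟨ solve 4 (λ a b c d → (a :+ b) :+ (c :+ d) := (a :+ c) :+ (b :+ d)) refl _ _ _ _ ⟩
    (f i - g i) + (_ - _)              ≈⟨ +-congˡ (trans (+-congʳ (sum-cong-≋ (λ j → f≈g (punchIn i j) (punchInᵢ≢i i j)))) (-‿inverseʳ _)) ⟩
    (f i - g i) + 0#                   ≈⟨ +-identityʳ _ ⟩
    f i - g i ∎
    where open ≈-Reasoning

  translate : ∀ {x y x′ y′} → x′ - y′ ≈ x - y → x′ ≈ x + (y′ - y)
  translate {x} {y} {x′} {y′} eq = begin
    x′                     ≈⟨ +-identityʳ x′ ⟨
    x′ + 0#                ≈⟨ +-congˡ (-‿inverseˡ y′) ⟨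
    x′ + (- y′ + y′)       ≈⟨ +-assoc _ _ _ ⟨
    (x′ - y′) + y′         ≈⟨ +-congʳ eq ⟩
    (x - y) + y′           ≈⟨ solve 3 (λ a b c → (a :+ b) :+ c := a :+ (c :+ b)) refl x (- y) y′ ⟩
    x + (y′ - y) ∎
    where open ≈-Reasoning

  -- How two cubes lie relative to each other in one coordinate depends only on this difference, so
  -- a map that preserves it preserves `Below` and `Far`.
  Δ : (Fin N → Carrier) → Fin N → Fin N → Carrier
  Δ ψ u w = ψ u - ψ w

  _Below[_]_ : Fin N → (Fin N → Carrier) → Fin N → Set
  u Below[ ψ ] w = ψ u + 1# < ψ w

  below-cong : ∀ (ψ ψ′ : Fin N → Carrier) {u w} → Δ ψ′ u w ≈ Δ ψ u w → u Below[ ψ ] w → u Below[ ψ′ ] w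
  below-cong ψ ψ′ {u} {w} eq below = ≤-<-trans (≤-reflexive shift)
    (<-≤-trans (+-monoˡ-< (ψ′ w - ψ w) below) (≤-reflexive back))
    where
    shift : ψ′ u + 1# ≈ (ψ u + 1#) + (ψ′ w - ψ w)
    shift = trans (+-congʳ (translate eq))
      (solve 3 (λ a b c → (a :+ b) :+ c := (a :+ c) :+ b) refl (ψ u) _ 1#)
    back : ψ w + (ψ′ w - ψ w) ≈ ψ′ w
    back = proj₂ (difference (ψ w) (ψ′ w))

  Far : (Fin N → Carrier) → Rel (Fin N) 0ℓ
  Far ψ u w = u Below[ ψ ] w ⊎ w Below[ ψ ] u

  far-cong : ∀ (ψ ψ′ : Fin N → Carrier) {u w} → Δ ψ′ u w ≈ Δ ψ u w → Far ψ u w → Far ψ′ u w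
  far-cong ψ ψ′ eq (inj₁ below) = inj₁ (below-cong ψ ψ′ eq below)
  far-cong ψ ψ′ {u} {w} eq (inj₂ below) = inj₂ (below-cong ψ ψ′ flipped below)
    where
    flipped : Δ ψ′ w u ≈ Δ ψ w u
    flipped = sym (+-cancelˡ (ψ u - ψ w) (begin
      (ψ u - ψ w) + (ψ w - ψ u)      ≈⟨ zero-sum (ψ u) (ψ w) ⟩
      0#                             ≈⟨ zero-sum (ψ′ u) (ψ′ w) ⟨
      (ψ′ u - ψ′ w) + (ψ′ w - ψ′ u)  ≈⟨ +-congʳ eq ⟩
      (ψ u - ψ w) + (ψ′ w - ψ′ u)    ∎))
      where
      open ≈-Reasoning
      zero-sum : ∀ x y → (x - y) + (y - x) ≈ 0#
      zero-sum x y = trans (solve 4 (λ x y x′ y′ → (x :+ y′) :+ (y :+ x′) := (x :+ x′) :+ (y :+ y′)) refl x y (- x) (- y))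
        (trans (+-cong (-‿inverseʳ x) (-‿inverseʳ y)) (+-identityˡ 0#))

  large-gap : ∀ x y a b → EventuallyLarge (λ s → a < b → (x + s * a) + 1# < y + s * b)
  large-gap x y a b with decide (a < b)
  ... | no a≮b = 0# , λ _ a<b → contradiction a<b a≮b
  ... | yes a<b =
    let (d , 0<d , a+d≈b)   = gap a<b
        (e , 0<e , de≈1)    = positive-inverse 0<d
        (t , y+t≈x+2)       = difference y ((x + 1#) + 1#)
    -- Here `t` is x + 2 - y and `e` is the inverse of b - a. From s at least `t * e` follows that
    -- s(b - a) is at least `t`, which leaves a gap of two where more than one is wanted.
    in t * e , λ {s} te≤s _ → bound s d e t 0<d a+d≈b de≈1 y+t≈x+2 te≤s
    where
    bound : ∀ s d e t → 0# < d → a + d ≈ b → d * e ≈ 1# → y + t ≈ (x + 1#) + 1# → t * e ≤ s →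
            (x + s * a) + 1# < y + s * b
    bound s d e t 0<d a+d≈b de≈1 y+t≈x+2 te≤s = <-≤-trans (x<x+y _ 0<1)
      (≤-trans (≤-reflexive (begin
        ((x + s * a) + 1#) + 1#   ≈⟨ solve 3 (λ x y z → ((x :+ y) :+ z) :+ z := ((x :+ z) :+ z) :+ y) refl x (s * a) 1# ⟩
        ((x + 1#) + 1#) + s * a   ≈⟨ +-congʳ y+t≈x+2 ⟨
        (y + t) + s * a           ≈⟨ +-congʳ (+-congˡ t≈) ⟩
        (y + d * (t * e)) + s * a ∎))
      (≤-trans (+-monoˡ-≤ (s * a) (+-monoʳ-≤ y (*-monoʳ-≤ (<⇒≤ 0<d) te≤s)))
        (≤-reflexive (begin
          (y + d * s) + s * a     ≈⟨ solve 4 (λ y d s a → (y :+ d :* s) :+ s :* a := y :+ s :* (a :+ d)) refl y d s a ⟩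
          y + s * (a + d)         ≈⟨ +-congˡ (*-congˡ a+d≈b) ⟩
          y + s * b               ∎))))
      where
      open ≈-Reasoning
      t≈ : t ≈ d * (t * e)
      t≈ = sym (trans (solve 3 (λ d t e → d :* (t :* e) := t :* (d :* e)) refl d t e)
        (trans (*-congˡ de≈1) (*-identityʳ t)))

  -- A lexicographic combination: `g` decides first, and `ψ` is kept among vertices with equal `g`.
  -- It is `ψ` plus a multiple of `g` by a factor large enough for all of the finitely many pairs.
  stretch : (ψ g : Fin N → Carrier) → Σ[ ψ′ ∈ (Fin N → Carrier) ]
    ((∀ {u w} → g u < g w → u Below[ ψ′ ] w) × (∀ {u w} → g u ≈ g w → Δ ψ′ u w ≈ Δ ψ u w))
  stretch {N} ψ g =
    let (s , large) = large-∀ (λ u → large-∀ (λ w → large-gap (ψ u) (ψ w) (g u) (g w)))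
    in (λ v → ψ v + s * g v) , (λ {u} {w} → large ≤-refl u w) , λ {u} {w} → preserve s u w
    where
    preserve : ∀ s u w → g u ≈ g w → (ψ u + s * g u) - (ψ w + s * g w) ≈ ψ u - ψ w
    preserve s u w gu≈gw = begin
      (ψ u + s * g u) - (ψ w + s * g w)        ≈⟨ +-congˡ (-‿+-comm _ _) ⟨
      (ψ u + s * g u) + (- ψ w + - (s * g w))  ≈⟨ solve 4 (λ a b c d → (a :+ b) :+ (c :+ d) := (a :+ c) :+ (b :+ d)) refl _ _ _ _ ⟩
      (ψ u - ψ w) + (s * g u - s * g w)        ≈⟨ +-congˡ (trans (+-congʳ (*-congˡ gu≈gw)) (-‿inverseʳ _)) ⟩
      (ψ u - ψ w) + 0#                         ≈⟨ +-identityʳ _ ⟩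
      ψ u - ψ w ∎
      where open ≈-Reasoning

  record Stretched {k} (ψ : Fin N → Carrier) (g : Fin k → Fin N → Carrier) : Set where
    field
      map       : Fin N → Carrier
      preserves : ∀ {u w} → (∀ q → g q u ≈ g q w) → Δ map u w ≈ Δ ψ u w
      stretches : ∀ q {u w} → g q u < g q w → (∀ q′ → q′ ≢ q → g q′ u ≈ g q′ w) → u Below[ map ] w
      far       : ∀ {u w} → Far ψ u w → Far map u w

  -- The functions are added one after the other. A far pair remains far: either the new function
  -- differs on it and pushes it apart, possibly reversing its order, or the difference is
  -- unchanged.
  stretch-all : ∀ {k} (ψ : Fin N → Carrier) (g : Fin k → Fin N → Carrier) → Stretched ψ g
  stretch-all {k = zero} ψ g = record
    { map = ψ ; preserves = λ _ → refl ; stretches = λ () ; far = λ f → f }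
  stretch-all {N} {suc k} ψ g = record
    { map = Stretched.map rest
    ; preserves = λ eq → trans (Stretched.preserves rest (λ q → eq (suc q))) (preserves₁ (eq zero))
    ; stretches = λ
      { zero lt eq → below-cong ψ₁ (Stretched.map rest) (Stretched.preserves rest (λ q → eq (suc q) (λ ()))) (stretches₁ lt)
      ; (suc q) lt eq → Stretched.stretches rest q lt (λ q′ q′≢q → eq (suc q′) (λ { ≡.refl → q′≢q ≡.refl })) }
    ; far = λ f → Stretched.far rest (far₁ f)
    }
    where
    ψ₁ : Fin N → Carrier
    ψ₁ = proj₁ (stretch ψ (g zero))
    stretches₁ : ∀ {u w} → g zero u < g zero w → u Below[ ψ₁ ] w
    stretches₁ = proj₁ (proj₂ (stretch ψ (g zero)))
    preserves₁ : ∀ {u w} → g zero u ≈ g zero w → Δ ψ₁ u w ≈ Δ ψ u w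
    preserves₁ = proj₂ (proj₂ (stretch ψ (g zero)))
    rest : Stretched ψ₁ (g ∘ suc)
    rest = stretch-all ψ₁ (g ∘ suc)
    far₁ : ∀ {u w} → Far ψ u w → Far ψ₁ u w
    far₁ {u} {w} f with compare (g zero u) (g zero w)
    ... | inj₁ lt        = inj₁ (stretches₁ lt)
    ... | inj₂ (inj₁ eq) = far-cong ψ ψ₁ (preserves₁ eq) f
    ... | inj₂ (inj₂ gt) = inj₂ (stretches₁ gt)

  fromNat : ℕ → Carrier
  fromNat zero    = 0#
  fromNat (suc n) = 1# + fromNat n

  fromNat-mono-< : ∀ {a b} → a ℕ.< b → fromNat a < fromNat b
  fromNat-mono-< {zero}  {suc b} _ = <-≤-trans 0<1 (≤-respˡ-≈ (+-identityʳ 1#) (+-monoʳ-≤ 1# (nonNeg b)))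
    where
    nonNeg : ∀ n → 0# ≤ fromNat n
    nonNeg zero    = ≤-refl
    nonNeg (suc n) = ≤-trans (<⇒≤ 0<1) (≤-respˡ-≈ (+-identityʳ 1#) (+-monoʳ-≤ 1# (nonNeg n)))
  fromNat-mono-< {suc a} {suc b} (ℕ.s≤s lt) = +-monoʳ-< 1# (fromNat-mono-< lt)

-- Gluing panel layouts into a cube layout of a tree.

module Assembly (em : ExcludedMiddle 0ℓ) (ℝ : Reals) where
  open Classical em
  open Geometry em ℝ
  open Panels em ℝ
  open Stretch em ℝ
  open Reals ℝ hiding (zero)
  open SumProperties +-commutativeMonoid using (sum)
  open SemigroupProperties +-commutativeSemigroup using (xy∙z≈xz∙y)

  -- Each edge belongs to exactly one part, and parts of equal colour share no vertex. Parts of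
  -- different colours may meet in vertices, which is where they are glued.
  record Decomposition (m : ℕ) (T : Graph N) : Set where
    field
      size          : ℕ
      part          : Fin size → Graph N
      colour        : Fin size → Fin (suc m)
      part⊑         : ∀ q → part q ⊑ T
      covers        : ∀ {u v} → Adj T u v → ∃[ q ] Adj (part q) u v
      edge-unique   : ∀ {q q′ u v} → Adj (part q) u v → Adj (part q′) u v → q ≡ q′
      vertex-unique : ∀ {q q′ v} → colour q ≡ colour q′ →
                      v ∈ vertices (part q) → v ∈ vertices (part q′) → q ≡ q′
      connected     : ∀ q → Connected (part q)
      layout        : ∀ q → PanelLayout m (part q)

  module _ {m} {T : Graph N} (T-connected : Connected T) (acyclic : Acyclic T)
           (origin : Fin N) (decomposition : Decomposition m T) where

    open Decomposition decomposition

    private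
      module L q = PanelLayout (layout q)

      Avoiding : Fin size → Rel (Fin N) 0ℓ
      Avoiding q x y = Adj T x y × ¬ Adj (part q) x y

      Avoiding-sym : ∀ q → Symmetric (Avoiding q)
      Avoiding-sym q (e , ¬e) = adj-sym T e , λ e′ → ¬e (adj-sym (part q) e′)

      -- The vertex of the part nearest to `v`, described by a walk that reaches it without using
      -- edges of the part.
      IsGate : Fin size → Fin N → Fin N → Set
      IsGate q v x = x ∈ vertices (part q) × Star (Avoiding q) v x

      -- Two gates are joined inside the part and also by a walk avoiding its edges. By `meet` these
      -- would share an edge unless the gates coincide.
      gate-unique : ∀ {q v x y} → IsGate q v x → IsGate q v y → x ≡ y
      gate-unique {q} {v} {x} {y} (x∈ , v⇝x) (y∈ , v⇝y)
        with meet {G = T} acyclic (λ e → edge (part⊑ q) e) proj₁ (connected q x y x∈ y∈)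
               (reverse (Avoiding-sym q) v⇝x ◅◅ v⇝y)
      ... | ε = ≡.refl
      ... | (e , _ , ¬e) ◅ _ = contradiction e ¬e

      -- The value origin is irrelevant: it is only taken where part q is out of reach.
      gate : Fin size → Fin N → Fin N
      gate q v with decide (∃ (IsGate q v))
      ... | yes (x , _) = x
      ... | no _        = origin

      gate-IsGate : ∀ {q v x} → IsGate q v x → gate q v ≡ x
      gate-IsGate {q} {v} g with decide (∃ (IsGate q v))
      ... | yes (y , g′) = gate-unique {q} {v} g′ g
      ... | no none      = contradiction (_ , g) none

      gate-none : ∀ {q v} → ¬ ∃ (IsGate q v) → gate q v ≡ origin
      gate-none {q} {v} none with decide (∃ (IsGate q v))
      ... | yes g = contradiction g none
      ... | no _  = ≡.refl

      gate-cong : ∀ {q u w} → Star (Avoiding q) u w → gate q u ≡ gate q w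
      gate-cong {q} {u} {w} u⇝w = by-cases (decide (∃ (IsGate q w)))
        where
        by-cases : Dec (∃ (IsGate q w)) → gate q u ≡ gate q w
        by-cases (yes (x , x∈ , w⇝x)) =
          ≡.trans (gate-IsGate {q} {u} (x∈ , u⇝w ◅◅ w⇝x)) (≡.sym (gate-IsGate {q} {w} (x∈ , w⇝x)))
        by-cases (no none) = ≡.trans
          (gate-none {q} {u} (λ (x , x∈ , u⇝x) → none (x , x∈ , reverse (Avoiding-sym q) u⇝w ◅◅ u⇝x)))
          (≡.sym (gate-none {q} {w} none))

      gate-self : ∀ {q x} → x ∈ vertices (part q) → gate q x ≡ x
      gate-self {q} {x} x∈ = gate-IsGate {q} {x} (x∈ , ε)

      -- A walk inside one part uses no edge of another. Hence every contribution of the other parts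
      -- to a coordinate is constant on the part.
      gate-other : ∀ {q q′ x y} → x ∈ vertices (part q) → y ∈ vertices (part q) → q′ ≢ q →
                   gate q′ x ≡ gate q′ y
      gate-other {q} {q′} {x} {y} x∈ y∈ q′≢q = gate-cong {q′}
        (mapStar (λ e → edge (part⊑ q) e , λ e′ → q′≢q (edge-unique e′ e)) (connected q x y x∈ y∈))

      Colourless : Fin (suc m) → Rel (Fin N) 0ℓ
      Colourless j x y = Adj T x y × ¬ (∃[ q ] (colour q ≡ j × Adj (part q) x y))

      Colourless-sym : ∀ j → Symmetric (Colourless j)
      Colourless-sym j (e , none) = adj-sym T e , λ (q , eq , e′) → none (q , eq , adj-sym (part q) e′)

      part-colourless : ∀ {q j x y} → colour q ≢ j → x ∈ vertices (part q) → y ∈ vertices (part q) →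
                        Star (Colourless j) x y
      part-colourless {q} {j} {x} {y} q≢j x∈ y∈ = mapStar
        (λ e → edge (part⊑ q) e , λ (q′ , eq , e′) → q≢j (≡.trans (cong colour (edge-unique e e′)) eq))
        (connected q x y x∈ y∈)

      -- The panels of a part extend in all directions except its colour, so `punchOut` renumbers
      -- the remaining ones as panel coordinates. The heights go into the direction of the colour,
      -- as `lift`. The value `0#` marks a part without a contribution.
      sideways : Fin (suc m) → Fin size → Fin N → Carrier
      sideways j q v with colour q ≟ j
      ... | yes _  = 0#
      ... | no q≢j = L.base q (gate q v) (punchOut q≢j)

      lift : Fin (suc m) → Fin size → Fin N → Carrier
      lift j q v with colour q ≟ j
      ... | yes _ = L.height q (gate q v)
      ... | no _  = 0#

      sideways-cong : ∀ {j q x y} → gate q x ≡ gate q y → sideways j q x ≈ sideways j q y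
      sideways-cong {j} {q} eq with colour q ≟ j
      ... | yes _  = refl
      ... | no q≢j = reflexive (cong (λ v → L.base q v (punchOut q≢j)) eq)

      lift-cong : ∀ {j q x y} → gate q x ≡ gate q y → lift j q x ≈ lift j q y
      lift-cong {j} {q} eq with colour q ≟ j
      ... | yes _ = reflexive (cong (L.height q) eq)
      ... | no _  = refl

      sideways-self : ∀ {q x} k → x ∈ vertices (part q) →
                      sideways (punchIn (colour q) k) q x ≡ L.base q x k
      sideways-self {q} {x} k x∈ with colour q ≟ punchIn (colour q) k
      ... | yes eq = contradiction (≡.sym eq) (punchInᵢ≢i (colour q) k)
      ... | no q≢j = ≡.cong₂ (L.base q) (gate-self {q} x∈)
        (≡.trans (punchOut-cong (colour q) ≡.refl) (punchOut-punchIn (colour q)))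

      lift-self : ∀ {q x} → x ∈ vertices (part q) → lift (colour q) q x ≡ L.height q x
      lift-self {q} x∈ with colour q ≟ colour q
      ... | yes _  = cong (L.height q) (gate-self {q} x∈)
      ... | no q≢q = contradiction ≡.refl q≢q

      lift-elsewhere : ∀ {q j x y} → colour q ≢ j → lift j q x ≈ lift j q y
      lift-elsewhere {q} {j} q≢j with colour q ≟ j
      ... | yes eq = contradiction eq q≢j
      ... | no _   = refl

      class : Fin (suc m) → Fin N → Carrier
      class j v = fromNat (toℕ (representative {R = Colourless j} (Colourless-sym j) v))

      spread : ∀ j → Fin N → Carrier
      spread j v = sum (λ q → sideways j q v)

      separated : ∀ j → Σ[ ψ ∈ (Fin N → Carrier) ]
        ((∀ {u w} → class j u < class j w → u Below[ ψ ] w) ×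
         (∀ {u w} → class j u ≈ class j w → Δ ψ u w ≈ Δ (spread j) u w))
      separated j = stretch (spread j) (class j)

      stretched : ∀ j → Stretched (proj₁ (separated j)) (lift j)
      stretched j = stretch-all (proj₁ (separated j)) (lift j)

      -- Three levels of increasing weight: the sum of the sideways coordinates, the class under
      -- paths avoiding colour `j`, and the heights of the parts of colour `j`. On a part of another
      -- colour only the first level varies; on a part of colour `j` its own heights decide.
      position : Fin N → Point ℝ (suc m)
      position v j = Stretched.map (stretched j) v

      -- In a direction other than its colour, the part has constant lifts and lies in one class,
      -- and only its own summand of `spread` varies. Its layout thus reappears up to translation.
      position-base : ∀ {q x y} k → x ∈ vertices (part q) → y ∈ vertices (part q) →
        position x (punchIn (colour q) k) - position y (punchIn (colour q) k) ≈ L.base q x k - L.base q y k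
      position-base {q} {x} {y} k x∈ y∈ = begin
        position x j - position y j              ≈⟨ Stretched.preserves (stretched j) same-lift ⟩
        Δ (proj₁ (separated j)) x y              ≈⟨ proj₂ (proj₂ (separated j)) same-class ⟩
        spread j x - spread j y                  ≈⟨ sum-swap _ _ q (λ q′ q′≢q → sideways-cong {j} {q′} (gate-other {q} {q′} x∈ y∈ q′≢q)) ⟩
        sideways j q x - sideways j q y          ≡⟨ ≡.cong₂ _-_ (sideways-self {q} k x∈) (sideways-self {q} k y∈) ⟩
        L.base q x k - L.base q y k ∎
        where
        open ≈-Reasoning
        j = punchIn (colour q) k
        q≢j : colour q ≢ j
        q≢j eq = punchInᵢ≢i (colour q) k (≡.sym eq)
        same-class : class j x ≈ class j y
        same-class = reflexive (cong (λ v → fromNat (toℕ v))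
          (representative-cong {R = Colourless j} (Colourless-sym j) (part-colourless {q} q≢j x∈ y∈)))
        same-lift : ∀ q′ → lift j q′ x ≈ lift j q′ y
        same-lift q′ with q′ ≟ q
        ... | yes ≡.refl = lift-elsewhere {q} q≢j
        ... | no q′≢q    = lift-cong {j} {q′} (gate-other {q} {q′} x∈ y∈ q′≢q)

      position-height : ∀ {q x y} → x ∈ vertices (part q) → y ∈ vertices (part q) →
        L.height q x < L.height q y → Above position (colour q) x y
      position-height {q} {x} {y} x∈ y∈ x<y = Stretched.stretches (stretched (colour q)) q
        (≡.subst₂ _<_ (≡.sym (lift-self {q} x∈)) (≡.sym (lift-self {q} y∈)) x<y)
        (λ q′ q′≢q → lift-cong {colour q} {q′} (gate-other {q} {q′} x∈ y∈ q′≢q))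

      position-far : ∀ j {u w} → ¬ Star (Colourless j) u w → Above position j u w ⊎ Above position j w u
      position-far j {u} {w} apart = Stretched.far (stretched j) class-far
        where
        class-far : Far (proj₁ (separated j)) u w
        class-far with ℕₚ.<-cmp (toℕ (representative {R = Colourless j} (Colourless-sym j) u)) (toℕ (representative {R = Colourless j} (Colourless-sym j) w))
        ... | tri< lt _ _ = inj₁ (proj₁ (proj₂ (separated j)) (fromNat-mono-< lt))
        ... | tri≈ _ eq _ = contradiction (representative-reflects {R = Colourless j} (Colourless-sym j) (toℕ-injective eq)) apart
        ... | tri> _ _ gt = inj₂ (proj₁ (proj₂ (separated j)) (fromNat-mono-< gt))

      overlap⇒colourless : ∀ j {u w x} → position u j ≤ x → x ≤ position u j + 1# →
        position w j ≤ x → x ≤ position w j + 1# → Star (Colourless j) u w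
      overlap⇒colourless j {u} {w} u≤x x≤u w≤x x≤w = decidable-stable (decide _) λ apart →
        [ <⇒≱′ (≤-trans w≤x x≤u) , <⇒≱′ (≤-trans u≤x x≤w) ] (position-far j apart)
        where
        <⇒≱′ : ∀ {x y} → y ≤ x → ¬ x < y
        <⇒≱′ y≤x x<y = <⇒≱ x<y y≤x

      -- The walks avoiding the single colours intersect in a walk without any colour. Every edge
      -- has a colour, so this walk is empty. Disjointness of the cubes follows.
      colourless-everywhere : ∀ {u w} → u ∈ vertices T → w ∈ vertices T →
        (∀ j → Star (Colourless j) u w) → u ≡ w
      colourless-everywhere {u} {w} u∈ w∈ joined
        with ⋂-meet {G = T} acyclic {R = Colourless} (λ _ → proj₁) (T-connected u w u∈ w∈) joined
      ... | ε = ≡.refl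
      ... | (e , avoids) ◅ _ =
        let (q , e′) = covers e in contradiction (q , ≡.refl , e′) (proj₂ (avoids (colour q)))

      -- The intersection of the walks uses colour `i` only. Consecutive edges of it share a vertex,
      -- and parts of equal colour are vertex-disjoint, so the whole walk stays in the part of its
      -- first edge.
      same-part : ∀ i {u w} → u ∈ vertices T → w ∈ vertices T → u ≢ w →
        (∀ j → j ≢ i → Star (Colourless j) u w) →
        ∃[ q ] (colour q ≡ i × u ∈ vertices (part q) × w ∈ vertices (part q))
      same-part i {u} {w} u∈ w∈ u≢w joined = first
        (mapStar monochromatic (⋂-meet {G = T} acyclic {R = R} (λ _ → proj₁) (T-connected u w u∈ w∈) walks))
        where
        R : Fin (suc m) → Rel (Fin N) 0ℓ
        -- For colour `i` the condition is vacuous, so that one family indexed by all colours can be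
        -- passed to `⋂-meet`.
        R j x y = Adj T x y × (j ≢ i → ¬ (∃[ q ] (colour q ≡ j × Adj (part q) x y)))
        walks : ∀ j → Star (R j) u w
        walks j with j ≟ i
        ... | yes j≡i = mapStar (λ e → e , λ j≢i → contradiction j≡i j≢i) (T-connected u w u∈ w∈)
        ... | no j≢i  = mapStar (λ (e , none) → e , λ _ → none) (joined j j≢i)
        Mono : Rel (Fin N) 0ℓ
        Mono x y = ∃[ q ] (colour q ≡ i × Adj (part q) x y)
        monochromatic : ∀ {x y} → Adj T x y × (∀ j → R j x y) → Mono x y
        monochromatic (e , avoids) with covers e
        ... | q , e′ with colour q ≟ i
        ... | yes q≡i = q , q≡i , e′
        ... | no q≢i  = contradiction (q , ≡.refl , e′) (proj₂ (avoids (colour q)) q≢i)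
        first : Star Mono u w → _
        first ε = contradiction ≡.refl u≢w
        first ((q , q≡i , e) ◅ es) = q , q≡i , adj-vertex (part q) e ,
          ∈-Star (_∈ vertices (part q)) continue (adj-vertex (part q) (adj-sym (part q) e)) es
          where
          continue : ∀ {x y} → x ∈ vertices (part q) → Mono x y → y ∈ vertices (part q)
          continue {x} {y} x∈ (q′ , q′≡i , e′) =
            subst (λ q → y ∈ vertices (part q))
              (vertex-unique (≡.trans q′≡i (≡.sym q≡i)) (adj-vertex (part q′) e′) x∈)
              (adj-vertex (part q′) (adj-sym (part q′) e′))

      overlap⇒same-part : ∀ i {u w p} → u ∈ vertices T → w ∈ vertices T → u ≢ w →
        HalfOpen (side position i u) p → HalfOpen (side position i w) p →
        ∃[ q ] (colour q ≡ i × u ∈ vertices (part q) × w ∈ vertices (part q))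
      overlap⇒same-part i {u} {w} {p} u∈ w∈ u≢w p∈u p∈w = same-part i u∈ w∈ u≢w joined
        where
        joined : ∀ j → j ≢ i → Star (Colourless j) u w
        joined j j≢i = subst (λ j → Star (Colourless j) u w) (punchIn-punchOut i≢j)
          (let k = punchOut i≢j in overlap⇒colourless (punchIn i k)
            (proj₁ (p∈u k)) (<⇒≤ (proj₂ (p∈u k))) (proj₁ (p∈w k)) (<⇒≤ (proj₂ (p∈w k))))
          where
          i≢j : i ≢ j
          i≢j eq = j≢i (≡.sym eq)

      disjoint : ∀ u w → u ∈ vertices T → w ∈ vertices T → u ≢ w →
                 Disjoint ℝ (Cube ℝ (position u)) (Cube ℝ (position w))
      disjoint u w u∈ w∈ u≢w x (x∈u , x∈w) = u≢w (colourless-everywhere u∈ w∈ λ j →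
        overlap⇒colourless j (proj₁ (x∈u j)) (proj₂ (x∈u j)) (proj₁ (x∈w j)) (proj₂ (x∈w j)))

      module _ q {u w} (u∈ : u ∈ vertices (part q)) (w∈ : w ∈ vertices (part q)) where

        -- The translation taking panel boxes of the part to the cross-sections of its cubes. It is
        -- read off at `u`, and `position-base` makes it valid for every vertex of the part.
        offset : Fin m → Carrier
        offset k = side position (colour q) u k - L.base q u k

        side≈ : ∀ {x} → x ∈ vertices (part q) → ∀ k → side position (colour q) x k ≈ L.base q x k + offset k
        side≈ x∈ k = translate (position-base {q} k x∈ u∈)

        shift : ∀ {x p} → x ∈ vertices (part q) → HalfOpen (L.base q x) p →
                HalfOpen (side position (colour q) x) (λ k → p k + offset k)
        shift x∈ p∈x k =
          ≤-respˡ-≈ (sym (side≈ x∈ k)) (+-monoˡ-≤ (offset k) (proj₁ (p∈x k)))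
          , <-≤-trans (+-monoˡ-< (offset k) (proj₂ (p∈x k))) (≤-reflexive
              (trans (xy∙z≈xz∙y _ _ _) (+-congʳ (sym (side≈ x∈ k)))))

        unshift : ∀ {x p} → x ∈ vertices (part q) → HalfOpen (side position (colour q) x) (λ k → p k + offset k) →
                  HalfOpen (L.base q x) p
        unshift {x} {p} x∈ p∈x k =
          +-cancelʳ-≤ (≤-respˡ-≈ (side≈ x∈ k) (proj₁ (p∈x k)))
          , +-cancelʳ-< (<-≤-trans (proj₂ (p∈x k)) (≤-reflexive
              (trans (+-congʳ (side≈ x∈ k)) (xy∙z≈xz∙y _ _ _))))
          where
          +-cancelʳ-≤ : ∀ {a b c} → a + c ≤ b + c → a ≤ b
          +-cancelʳ-≤ {c = c} le = ≮⇒≥ (λ b<a → <⇒≱ (+-monoˡ-< c b<a) le)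
          +-cancelʳ-< : ∀ {a b c} → a + c < b + c → a < b
          +-cancelʳ-< {c = c} lt = ≰⇒> (λ b≤a → <⇒≱ lt (+-monoˡ-≤ c b≤a))

        -- The converse of `position-height` over a common point: equal heights contradict
        -- `separated`, and the opposite order would reverse `Above`.
        above⇒height< : ∀ {x y p} → x ∈ vertices (part q) → y ∈ vertices (part q) →
          HalfOpen (L.base q x) p → HalfOpen (L.base q y) p →
          Above position (colour q) x y → L.height q x < L.height q y
        above⇒height< {x} {y} {p} x∈ y∈ p∈x p∈y above with compare (L.height q x) (L.height q y)
        ... | inj₁ x<y = x<y
        ... | inj₂ (inj₁ x≈y) = contradiction x≈y
          (L.separated q x∈ y∈ (λ { ≡.refl → above-asym position (colour q) above above }) p (closed p∈x) (closed p∈y))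
        ... | inj₂ (inj₂ y<x) = contradiction above
          (above-asym position (colour q) (position-height {q} y∈ x∈ y<x))

        -- A cube outside the part cannot block. Being over the line of sight, it overlaps `u` in
        -- all directions but the colour, so `overlap⇒same-part` and `vertex-unique` place it in the
        -- part after all, where the panels already exclude it.
        raise : Sees (vertices (part q)) (L.base q) (_<_ on L.height q) u w →
                Sees (vertices T) (side position (colour q)) (Above position (colour q)) u w
        raise (p , p∈u , p∈w , u<w , clear) = (λ k → p k + offset k) , shift {p = p} u∈ p∈u , shift {p = p} w∈ p∈w
          , position-height {q} u∈ w∈ u<w , clear′
          where
          member : ∀ z → z ∈ vertices T → HalfOpen (side position (colour q) z) (λ k → p k + offset k) → z ∈ vertices (part q)
          member z z∈T p∈z with z ≟ u
          ... | yes ≡.refl = u∈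
          ... | no z≢u =
            let (q′ , q′≡ , z∈ , u∈′) = overlap⇒same-part (colour q) z∈T (vertex (part⊑ q) u∈) z≢u p∈z (shift {p = p} u∈ p∈u)
            in subst (λ q → z ∈ vertices (part q)) (vertex-unique q′≡ u∈′ u∈) z∈
          clear′ : ∀ z → z ∈ vertices T → HalfOpen (side position (colour q) z) (λ k → p k + offset k) →
                   Above position (colour q) u z → Above position (colour q) z w → ⊥
          clear′ z z∈T p∈z u<z z<w = clear z z∈ p∈z′ (above⇒height< u∈ z∈ p∈u p∈z′ u<z) (above⇒height< z∈ w∈ p∈z′ p∈w z<w)
            where
            z∈   = member z z∈T p∈z
            p∈z′ = unshift {p = p} z∈ p∈z

        lower : Sees (vertices T) (side position (colour q)) (Above position (colour q)) u w →
                Sees (vertices (part q)) (L.base q) (_<_ on L.height q) u w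
        lower (p , p∈u , p∈w , u<w , clear) = p′ , p′∈ u∈ p∈u , p′∈ w∈ p∈w
          , above⇒height< u∈ w∈ (p′∈ u∈ p∈u) (p′∈ w∈ p∈w) u<w
          , λ z z∈ p∈z u<z z<w → clear z (vertex (part⊑ q) z∈) (∈p z∈ p∈z)
              (position-height {q} u∈ z∈ u<z) (position-height {q} z∈ w∈ z<w)
          where
          p′ : Point ℝ m
          p′ k = p k - offset k
          restore : ∀ k → p′ k + offset k ≈ p k
          restore k = trans (+-assoc _ _ _) (trans (+-congˡ (-‿inverseˡ _)) (+-identityʳ _))
          p′∈ : ∀ {x} → x ∈ vertices (part q) → HalfOpen (side position (colour q) x) p → HalfOpen (L.base q x) p′
          p′∈ x∈ p∈x = unshift {p = p′} x∈ λ k →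
            ≤-respʳ-≈ (sym (restore k)) (proj₁ (p∈x k)) , ≤-<-trans (≤-reflexive (restore k)) (proj₂ (p∈x k))
          ∈p : ∀ {x} → x ∈ vertices (part q) → HalfOpen (L.base q x) p′ → HalfOpen (side position (colour q) x) p
          ∈p x∈ p∈x k = let (l , h) = shift {p = p′} x∈ p∈x k in
            ≤-respʳ-≈ (restore k) l , ≤-<-trans (≤-reflexive (sym (restore k))) h

      adjacent⇒channel : ∀ {u w} → u ∈ vertices T → w ∈ vertices T → u ≢ w → Adj T u w →
        ∃[ i ] (U i × Channel ℝ (vertices T) (λ v → Cube ℝ (position v)) i u w)
      adjacent⇒channel u∈T w∈T u≢w e =
        let (q , e′) = covers e
            u∈ = adj-vertex (part q) e′
            w∈ = adj-vertex (part q) (adj-sym (part q) e′)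
        in colour q , _ , from (cube-channel⇔sees position (colour q) (vertices T) disjoint u∈T w∈T u≢w)
          (Sum.map (raise q u∈ w∈) (raise q w∈ u∈) (to (L.visible q u∈ w∈ u≢w) e′))

      sees⇒adjacent : ∀ i {u w} → u ∈ vertices T → w ∈ vertices T → u ≢ w →
        Sees (vertices T) (side position i) (Above position i) u w → Adj T u w
      sees⇒adjacent i u∈T w∈T u≢w s@(p , p∈u , p∈w , _) = conclude (overlap⇒same-part i u∈T w∈T u≢w p∈u p∈w) s
        where
        conclude : ∀ {i u w} → ∃[ q ] (colour q ≡ i × u ∈ vertices (part q) × w ∈ vertices (part q)) →
          Sees (vertices T) (side position i) (Above position i) u w → Adj T u w
        conclude (q , ≡.refl , u∈ , w∈) s@(_ , _ , _ , above , _) = edge (part⊑ q)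
          (from (L.visible q u∈ w∈ (λ { ≡.refl → above-asym position (colour q) above above })) (inj₁ (lower q u∈ w∈ s)))

    cubeVisibility : CubeVisibility ℝ (suc m) T
    cubeVisibility = position , disjoint , λ u w u∈ w∈ u≢w → mk⇔ (adjacent⇒channel u∈ w∈ u≢w)
      (λ (i , _ , ch) → [ sees⇒adjacent i u∈ w∈ u≢w
                        , (λ s → adj-sym T (sees⇒adjacent i w∈ u∈ (u≢w ∘ ≡.sym) s)) ]
        (to (cube-channel⇔sees position i (vertices T) disjoint u∈ w∈ u≢w) ch))

-- Members of a union, and the ceiling of a fraction.

part⊑union : ∀ {k} (F : Fin k → Graph N) → IsUnion G F → ∀ i → F i ⊑ G
part⊑union F (vertexUnion , edgeUnion) i =
  (λ v∈ → from (vertexUnion _) (i , v∈)) , (λ e → from (edgeUnion _ _) (i , e))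

-- `ceiling` unfolds to the negated floor of the negated fraction, and the floor to an integer
-- quotient times the sign of the denominator; that factor of one is removed first.
ceiling-≡ : ∀ b m {a} → ℤ.-[1+ b ] ℤ./ℕ suc m ≡ ℤ.- (+ a) → + a ≡ ceiling (+ suc b / suc m)
ceiling-≡ b m {a} eq = ≡.sym (≡.trans
  (cong ℤ.-_ (≡.trans (ℤₚ.*-identityˡ (ℤ.-[1+ b ] ℤ./ℕ suc m)) eq))
  (ℤₚ.neg-involutive (+ a)))

-[1+]/-exact : ∀ b m → suc b ℕ.% suc m ≡ 0 → ℤ.-[1+ b ] ℤ./ℕ suc m ≡ ℤ.- (+ (suc b ℕ./ suc m))
-[1+]/-exact b m eq with suc b ℕ.% suc m | eq
... | zero | _ = ≡.refl

-[1+]/-inexact : ∀ b m {r} → suc b ℕ.% suc m ≡ suc r → ℤ.-[1+ b ] ℤ./ℕ suc m ≡ ℤ.-[1+ suc b ℕ./ suc m ]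
-[1+]/-inexact b m eq with suc b ℕ.% suc m | eq
... | suc _ | _ = ≡.refl

-- The form in which the ceiling is used: the least number of groups of size `suc m` that hold `b`
-- forests. Integer division of a negative number branches on the remainder, hence the two cases.
ceiling-/ : ∀ b m → ∃[ a ] (+ a ≡ ceiling (+ b / suc m) × b ℕ.≤ a ℕ.* suc m ×
            (∀ j → b ℕ.≤ j ℕ.* suc m → a ℕ.≤ j))
ceiling-/ zero m = 0 , ≡.refl , ℕ.z≤n , λ _ _ → ℕ.z≤n
ceiling-/ (suc b) m = by-remainder (suc b ℕ.% suc m) ≡.refl
  where
  q = suc b ℕ./ suc m
  by-remainder : ∀ r → suc b ℕ.% suc m ≡ r →
    ∃[ a ] (+ a ≡ ceiling (+ suc b / suc m) × suc b ℕ.≤ a ℕ.* suc m × (∀ j → suc b ℕ.≤ j ℕ.* suc m → a ℕ.≤ j))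
  by-remainder r eq with ≡.trans (ℕ.m≡m%n+[m/n]*n (suc b) (suc m)) (cong (ℕ._+ q ℕ.* suc m) eq)
  by-remainder zero eq | exact = q , ceiling-≡ b m (-[1+]/-exact b m eq) , ℕₚ.≤-reflexive exact ,
    λ j b≤ → ℕₚ.*-cancelʳ-≤ q j (suc m) (≡.subst (ℕ._≤ j ℕ.* suc m) exact b≤)
  by-remainder (suc r) eq | exact = suc q , ceiling-≡ b m (-[1+]/-inexact b m eq) ,
    ℕₚ.≤-trans (ℕₚ.≤-reflexive exact) (ℕₚ.+-monoˡ-≤ _
      (≡.subst (ℕ._≤ suc m) eq (ℕₚ.<⇒≤ (ℕ.m%n<n (suc b) (suc m))))) ,
    λ j b≤ → ℕₚ.*-cancelʳ-< (suc m) q j (ℕₚ.<-≤-trans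
      (ℕₚ.≤-trans (ℕ.s≤s (ℕₚ.m≤n+m _ r)) (ℕₚ.≤-reflexive (≡.sym exact))) b≤)

-- Regrouping forests and comparing the minima.

module Arboricity (em : ExcludedMiddle 0ℓ) (ℝ : Reals) where
  open Classical em
  open Geometry em ℝ
  open Panels em ℝ
  open Assembly em ℝ
  open Reals ℝ using (0#; 1#; _<_; sym)

  minimum : ∀ {P : Pred ℕ 0ℓ} {k} → P k → ∃ (IsMinimum P)
  minimum {P} {k} Pk with least {suc k} (P ∘ toℕ) (fromℕ< ℕₚ.≤-refl , subst P (≡.sym (toℕ-fromℕ< ℕₚ.≤-refl)) Pk)
  ... | x , Px , min = toℕ x , Px , lower
    where
    lower : ∀ j → P j → toℕ x ℕ.≤ j
    lower j Pj with j ℕ.<? suc k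
    ... | yes j<k = subst (toℕ x ℕ.≤_) (toℕ-fromℕ< j<k) (min (fromℕ< j<k) (subst P (≡.sym (toℕ-fromℕ< j<k)) Pj))
    ... | no j≮k  = ℕₚ.≤-trans (ℕₚ.<⇒≤ (toℕ<n x)) (ℕₚ.≮⇒≥ j≮k)

  module _ {m} {G : Graph N} {F : Fin (suc m) → Graph N} (union : IsUnion G F)
           (forests : ∀ i → OrthogonalForest m (F i)) where

    private
      -- Assigning an edge to the first forest containing it makes the layers edge-disjoint, while
      -- they still cover all edges.
      layer : Fin (suc m) → Graph N
      layer i = graph (_∈ vertices (F i))
        (λ u v → Adj (F i) u v × (∀ j → toℕ j ℕ.< toℕ i → ¬ Adj (F j) u v))
        (λ (e , _) → adj-vertex (F i) e)
        (λ (e , new) → adj-sym (F i) e , λ j j<i e′ → new j j<i (adj-sym (F j) e′))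
        (λ (e , _) → adj-irrefl (F i) e)

      layer⊑ : ∀ i → layer i ⊑ F i
      layer⊑ i = ⟦⟧⁻ , λ e → proj₁ (bool⁻ e)

      layer-first : ∀ {i u v} → Adj (layer i) u v → ∀ j → toℕ j ℕ.< toℕ i → ¬ Adj (F j) u v
      layer-first e = proj₂ (bool⁻ e)

      layer-unique : ∀ {i j u v} → Adj (layer i) u v → Adj (layer j) u v → i ≡ j
      layer-unique {i} {j} e e′ with ℕₚ.<-cmp (toℕ i) (toℕ j)
      ... | tri< i<j _ _ = contradiction (edge (layer⊑ i) e) (layer-first e′ i i<j)
      ... | tri≈ _ eq _  = toℕ-injective eq
      ... | tri> _ _ j<i = contradiction (edge (layer⊑ j) e′) (layer-first e j j<i)

      layer-covers : ∀ {u v} → Adj G u v → ∃[ i ] Adj (layer i) u v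
      layer-covers {u} {v} e with least (λ i → Adj (F i) u v) (to (proj₂ union u v) e)
      ... | i , e′ , min = i , bool⁺ (e′ , λ j j<i e″ → ℕₚ.<⇒≱ j<i (min j e″))

      -- A part is numbered by a pair of a colour and a possible root, encoded by `combine`. Pairs
      -- whose component is empty are harmless.
      colour : Fin (suc m ℕ.* N) → Fin (suc m)
      colour q = proj₁ (remQuot {suc m} N q)

      centre : Fin (suc m ℕ.* N) → Fin N
      centre q = proj₂ (remQuot {suc m} N q)

      index-injective : ∀ {q q′} → colour q ≡ colour q′ → centre q ≡ centre q′ → q ≡ q′
      index-injective {q} {q′} c r = ≡.trans (≡.sym (combine-remQuot {suc m} N q))
        (≡.trans (≡.cong₂ combine c r) (combine-remQuot {suc m} N q′))

      part : Fin (suc m ℕ.* N) → Graph N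
      part q = component (layer (colour q)) (centre q)

      part⊑layer : ∀ q → part q ⊑ layer (colour q)
      part⊑layer q = component⊑ (layer (colour q)) (centre q)

      part⊑F : ∀ q → part q ⊑ F (colour q)
      part⊑F q = ⊑-trans {K = part q} {layer (colour q)} {F (colour q)} (part⊑layer q) (layer⊑ (colour q))

      vertex-unique : ∀ {q q′ v} → colour q ≡ colour q′ →
                      v ∈ vertices (part q) → v ∈ vertices (part q′) → q ≡ q′
      vertex-unique {q} {q′} {v} same v∈ v∈′ = index-injective same (≡.trans
        (≡.sym (component-root (layer (colour q)) v∈))
        (≡.trans (cong (λ i → root (layer i) v) same) (component-root (layer (colour q′)) v∈′)))

    decomposition : Decomposition m G
    decomposition = record
      { size          = suc m ℕ.* N
      ; part          = part
      ; colour        = colour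
      ; part⊑         = λ q → ⊑-trans {K = part q} {F (colour q)} {G} (part⊑F q) (part⊑union {G = G} F union (colour q))
      ; covers        = covers
      ; edge-unique   = λ {q} {q′} e e′ → vertex-unique
          (layer-unique {colour q} {colour q′} (edge (part⊑layer q) e) (edge (part⊑layer q′) e′))
          (adj-vertex (part q) e) (adj-vertex (part q′) e′)
      ; vertex-unique = vertex-unique
      ; connected     = λ q → component-connected (layer (colour q)) (centre q)
      ; layout        = λ q → forest-panels {H = F (colour q)} {K = part q} (forests (colour q)) (part⊑F q)
          (component-connected (layer (colour q)) (centre q))
      }
      where
      covers : ∀ {u v} → Adj G u v → ∃[ q ] Adj (part q) u v
      covers {u} {v} e =
        let (i , e′) = layer-covers e
        in combine i (root (layer i) u) ,
           subst (λ (j , r) → Adj (component (layer j) r) u v)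
             (≡.sym (remQuot-combine i (root (layer i) u))) (component-edge (layer i) e′)

  -- The gluing works on a connected graph, so the forests are first restricted to each tree `K`
  -- inside `G`. They remain forests because layouts pass to connected subgraphs.
  orthogonalForests⇒cubeForest : ∀ {m} {F : Fin (suc m) → Graph N} → Acyclic G → IsUnion G F →
    (∀ i → OrthogonalForest m (F i)) → CubeForest (suc m) G
  orthogonalForests⇒cubeForest {N = N} {G = G} {m} {F} acyclic union forests =
    forest {G = G} (CubeVisibility ℝ (suc m)) acyclic cubes
    where
    module _ (K : Graph N) (K⊑G : K ⊑ G) (K-acyclic : Acyclic K) where
      F∩K : Fin (suc m) → Graph N
      F∩K i = graph (λ v → v ∈ vertices K × v ∈ vertices (F i)) (λ u v → Adj K u v × Adj (F i) u v)
        (λ (e , e′) → adj-vertex K e , adj-vertex (F i) e′)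
        (λ (e , e′) → adj-sym K e , adj-sym (F i) e′) (λ (e , _) → adj-irrefl K e)
      F∩K⊑F : ∀ i → F∩K i ⊑ F i
      F∩K⊑F i = (λ v∈ → proj₂ (⟦⟧⁻ v∈)) , (λ e → proj₂ (bool⁻ e))
      F∩K⊑K : ∀ i → F∩K i ⊑ K
      F∩K⊑K i = (λ v∈ → proj₁ (⟦⟧⁻ v∈)) , (λ e → proj₁ (bool⁻ e))
      K-union : IsUnion K F∩K
      K-union =
        (λ v → mk⇔ (λ v∈ → map₂ (λ v∈i → ⟦⟧⁺ (v∈ , v∈i)) (to (proj₁ union v) (vertex K⊑G v∈)))
                   (λ (i , v∈) → vertex (F∩K⊑K i) v∈)) ,
        (λ u v → mk⇔ (λ e → map₂ (λ e′ → bool⁺ (e , e′)) (to (proj₂ union u v) (edge K⊑G e)))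
                     (λ (i , e) → edge (F∩K⊑K i) e))
      K-forests : ∀ i → OrthogonalForest m (F∩K i)
      K-forests i = orthogonalForest-⊑ {G = F∩K i} {H = F i}
        (acyclic-⊑ {H = F∩K i} {G = K} (F∩K⊑K i) K-acyclic) (F∩K⊑F i) (forests i)
    cubes : ∀ K → K ⊑ G → IsTree K → CubeVisibility ℝ (suc m) K
    -- The vertex witnessing that `K` is nonempty becomes the default value `origin` of the gates.
    cubes K K⊑G ((v , _) , connected , K-acyclic) = cubeVisibility {T = K} connected K-acyclic v
      (decomposition {G = K} {F = F∩K K K⊑G K-acyclic} (K-union K K⊑G K-acyclic) (K-forests K K⊑G K-acyclic))

  module _ {T : Graph N} (acyclic : Acyclic T) where

    Orthogonal Cubes : ℕ → ℕ → Set
    Orthogonal m k = UnionOf (ForestOf (CubeOrthogonalVisibility ℝ m)) k T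
    Cubes n k = UnionOf (ForestOf (CubeVisibility ℝ n)) k T

    cubes⇒orthogonal : ∀ {m k} → Cubes (suc m) k → Orthogonal m (k ℕ.* suc m)
    cubes⇒orthogonal {m} {k} (H , union@(vertexUnion , edgeUnion) , forests) =
      (λ x → family (remQuot {k} (suc m) x)) , (vertexUnion′ , edgeUnion′) , λ x → orthogonal (remQuot {k} (suc m) x)
      where
      split : ∀ c → Σ[ D ∈ (Fin (suc m) → Graph N) ] (IsUnion (H c) D × (∀ i → OrthogonalForest m (D i)))
      split c = cubeForest⇒orthogonalForests {H = H c} (acyclic-⊑ {H = H c} {G = T} (part⊑union {G = T} H union c) acyclic) (forests c)
      family : Fin k × Fin (suc m) → Graph N
      family (c , i) = proj₁ (split c) i
      orthogonal : ∀ x → OrthogonalForest m (family x)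
      orthogonal (c , i) = proj₂ (proj₂ (split c)) i
      at : ∀ (P : Graph N → Set) c i → P (family (c , i)) → ∃[ x ] P (family (remQuot {k} (suc m) x))
      at P c i p = combine c i , subst (P ∘ family) (≡.sym (remQuot-combine c i)) p
      vertexUnion′ : ∀ v → v ∈ vertices T ⇔ (∃[ x ] v ∈ vertices (family (remQuot {k} (suc m) x)))
      vertexUnion′ v = mk⇔
        (λ v∈ → let (c , v∈c) = to (vertexUnion v) v∈
                    (i , v∈i) = to (proj₁ (proj₁ (proj₂ (split c))) v) v∈c
                in at (λ G → v ∈ vertices G) c i v∈i)
        (λ (x , v∈x) → let (c , i) = remQuot {k} (suc m) x in
          from (vertexUnion v) (c , from (proj₁ (proj₁ (proj₂ (split c))) v) (i , v∈x)))
      edgeUnion′ : ∀ u v → Adj T u v ⇔ (∃[ x ] Adj (family (remQuot {k} (suc m) x)) u v)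
      edgeUnion′ u v = mk⇔
        (λ e → let (c , e′) = to (edgeUnion u v) e
                   (i , e″) = to (proj₂ (proj₁ (proj₂ (split c))) u v) e′
               in at (λ G → Adj G u v) c i e″)
        (λ (x , e) → let (c , i) = remQuot {k} (suc m) x in
          from (edgeUnion u v) (c , from (proj₂ (proj₁ (proj₂ (split c))) u v) (i , e)))

    orthogonal⇒cubes : ∀ {m} k → Orthogonal m (k ℕ.* suc m) → Cubes (suc m) k
    orthogonal⇒cubes {m} k (H , union@(vertexUnion , edgeUnion) , forests) =
      bundle , (vertexUnion′ , edgeUnion′) , λ c → orthogonalForests⇒cubeForest {G = bundle c} {F = λ i → H (combine c i)}
        (acyclic-⊑ {H = bundle c} {G = T} (bundle⊑ c) acyclic) (⋃-isUnion (λ i → H (combine c i))) (λ i → forests (combine c i))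
      where
      bundle : Fin k → Graph N
      bundle c = ⋃ (λ (i : Fin (suc m)) → H (combine c i))
      bundle⊑ : ∀ c → bundle c ⊑ T
      bundle⊑ c = (λ v∈ → let (i , v∈i) = ⟦⟧⁻ v∈ in from (vertexUnion _) (combine c i , v∈i))
                , (λ e → let (i , e′) = bool⁻ e in from (edgeUnion _ _) (combine c i , e′))
      at : ∀ (P : Graph N → Set) x → P (H x) → ∃[ c ] ∃[ i ] P (H (combine c i))
      at P x p = let (c , i) = remQuot {k} (suc m) x in
        c , i , subst (P ∘ H) (≡.sym (combine-remQuot {k} (suc m) x)) p
      vertexUnion′ : ∀ v → v ∈ vertices T ⇔ (∃[ c ] v ∈ vertices (bundle c))
      vertexUnion′ v = mk⇔
        (λ v∈ → let (x , v∈x) = to (vertexUnion v) v∈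
                    (c , i , v∈i) = at (λ G → v ∈ vertices G) x v∈x
                in c , ⟦⟧⁺ (i , v∈i))
        (λ (c , v∈) → vertex (bundle⊑ c) v∈)
      edgeUnion′ : ∀ u v → Adj T u v ⇔ (∃[ c ] Adj (bundle c) u v)
      edgeUnion′ u v = mk⇔
        (λ e → let (x , e′) = to (edgeUnion u v) e
                   (c , i , e″) = at (λ G → Adj G u v) x e′
               in c , bool⁺ (i , e″))
        (λ (c , e) → edge (bundle⊑ c) e)

    orthogonal-suc : ∀ {m k} → Orthogonal m k → Orthogonal m (suc k)
    orthogonal-suc {m} {k} (H , (vertexUnion , edgeUnion) , forests) =
      H′ , ((λ v → mk⇔ (λ v∈ → let (i , v∈i) = to (vertexUnion v) v∈ in suc i , v∈i)
                       (λ { (zero , v∈) → ⊥-elim (⟦⟧⁻ v∈) ; (suc i , v∈) → from (vertexUnion v) (i , v∈) }))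
           , (λ u v → mk⇔ (λ e → let (i , e′) = to (edgeUnion u v) e in suc i , e′)
                          (λ { (zero , e) → ⊥-elim (bool⁻ e) ; (suc i , e) → from (edgeUnion u v) (i , e) })))
         , λ { zero → orthogonalForest {G = ∅} (acyclic-⊑ {H = ∅} {G = T} ((λ v∈ → ⊥-elim (⟦⟧⁻ v∈)) , (λ e → ⊥-elim (bool⁻ e))) acyclic)
                        (λ K K⊑∅ _ → empty-panels (λ (v , v∈) → ⟦⟧⁻ (vertex K⊑∅ v∈)))
             ; (suc i) → forests i }
      where
      ∅ : Graph N
      ∅ = graph (λ _ → ⊥) (λ _ _ → ⊥) (λ ()) (λ ()) (λ ())
      H′ : Fin (suc k) → Graph N
      H′ zero    = ∅
      H′ (suc i) = H i

    -- Padding with empty forests, needed because the number of orthogonal forests need not be a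
    -- multiple of the dimension.
    orthogonal-≤ : ∀ {m k l} → k ℕ.≤ l → Orthogonal m k → Orthogonal m l
    orthogonal-≤ {m} {k} {l} k≤l o = subst (Orthogonal m) (ℕₚ.m∸n+n≡m k≤l) (extend (l ℕ.∸ k))
      where
      extend : ∀ d → Orthogonal m (d ℕ.+ k)
      extend zero    = o
      extend (suc d) = orthogonal-suc (extend d)

    -- Guarantees that the minimum exists. There is one graph for each pair of vertices, with all
    -- vertices and at most the edge joining the pair. A connected subgraph has at most two
    -- vertices; equal boxes at heights zero and one represent it, and no third height is available
    -- for blocking.
    orthogonal-exists : ∀ {m v} → v ∈ vertices T → Orthogonal m (N ℕ.* N)
    orthogonal-exists {m} {v₀} _ =
      -- Every `single x` contains all vertices, so any index would do here; `v₀` only supplies one.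
      single , ((λ v → mk⇔ (λ v∈ → combine v₀ v₀ , ⟦⟧⁺ v∈) (λ (x , v∈) → ⟦⟧⁻ v∈))
               , (λ u v → mk⇔ (λ e → combine u v , bool⁺ (e , inj₁ (here u v))) (λ (x , e) → edge (single⊑ x) e)))
             , λ x → orthogonalForest {G = single x} (acyclic-⊑ {H = single x} {G = T} (single⊑ x) acyclic) (panels x)
      where
      fst snd : Fin (N ℕ.* N) → Fin N
      fst x = proj₁ (remQuot {N} N x)
      snd x = proj₂ (remQuot {N} N x)
      here : ∀ u v → u ≡ fst (combine u v) × v ≡ snd (combine u v)
      here u v = cong proj₁ (≡.sym (remQuot-combine u v)) , cong proj₂ (≡.sym (remQuot-combine u v))
      Ends : Fin (N ℕ.* N) → Rel (Fin N) 0ℓ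
      Ends x u v = (u ≡ fst x × v ≡ snd x) ⊎ (v ≡ fst x × u ≡ snd x)
      single : Fin (N ℕ.* N) → Graph N
      single x = graph (_∈ vertices T) (λ u v → Adj T u v × Ends x u v)
        (λ (e , _) → adj-vertex T e) (λ (e , ends) → adj-sym T e , Sum.swap ends) (λ (e , _) → adj-irrefl T e)
      single⊑ : ∀ x → single x ⊑ T
      single⊑ x = ⟦⟧⁻ , λ e → proj₁ (bool⁻ e)
      module _ x K (K⊑ : K ⊑ single x) (connected : Connected K) where
        ends : ∀ {u v} → Adj K u v → Ends x u v
        ends e = proj₂ (bool⁻ (edge K⊑ e))
        pair : ∀ {u v} → u ∈ vertices K → v ∈ vertices K → u ≢ v → Adj K u v
        pair {u} {v} u∈ v∈ u≢v with connected u v u∈ v∈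
        ... | ε = contradiction ≡.refl u≢v
        -- Every vertex reached after the first step is one of the two ends. As `v` differs from
        -- `u`, it must be the far end of that first edge.
        ... | e ◅ es with ends e | ∈-Star (λ z → z ≡ fst x ⊎ z ≡ snd x) (λ _ e → [ inj₂ ∘ proj₂ , inj₁ ∘ proj₁ ] (ends e))
                                     ([ inj₂ ∘ proj₂ , inj₁ ∘ proj₁ ] (ends e)) es
        ... | inj₁ (u≡ , y≡) | inj₁ v≡ = contradiction (≡.trans u≡ (≡.sym v≡)) u≢v
        ... | inj₁ (u≡ , y≡) | inj₂ v≡ = subst (Adj K u) (≡.trans y≡ (≡.sym v≡)) e
        ... | inj₂ (y≡ , u≡) | inj₁ v≡ = subst (Adj K u) (≡.trans y≡ (≡.sym v≡)) e
        ... | inj₂ (y≡ , u≡) | inj₂ v≡ = contradiction (≡.trans u≡ (≡.sym v≡)) u≢v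
        height : Fin N → Reals.Carrier ℝ
        height v with v ≟ fst x
        ... | yes _ = 0#
        ... | no _  = 1#
        height-fst : ∀ {v} → v ≡ fst x → height v ≡ 0#
        height-fst {v} eq with v ≟ fst x
        ... | yes _ = ≡.refl
        ... | no ne = contradiction eq ne
        height-other : ∀ {v} → v ≢ fst x → height v ≡ 1#
        height-other {v} ne with v ≟ fst x
        ... | yes eq = contradiction eq ne
        ... | no _   = ≡.refl
        lower : ∀ {u v} → Ends x u v → u ≢ v → height u < height v ⊎ height v < height u
        lower {u} {v} (inj₁ (u≡ , _)) u≢v = inj₁ (≡.subst₂ _<_ (≡.sym (height-fst u≡))
          (≡.sym (height-other (λ v≡ → u≢v (≡.trans u≡ (≡.sym v≡))))) 0<1)
        lower {u} {v} (inj₂ (v≡ , _)) u≢v = inj₂ (≡.subst₂ _<_ (≡.sym (height-fst v≡))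
          (≡.sym (height-other (λ u≡ → u≢v (≡.trans u≡ (≡.sym v≡))))) 0<1)
        unblocked : ∀ {u z v} → height u < height z → height z < height v → ⊥
        unblocked {u} {z} {v} u<z z<v with u ≟ fst x | z ≟ fst x | v ≟ fst x
        ... | yes _ | yes _ | _     = <-irrefl u<z
        ... | no _  | no _  | _     = <-irrefl u<z
        ... | _     | yes _ | yes _ = <-irrefl z<v
        ... | _     | no _  | no _  = <-irrefl z<v
        ... | yes _ | no _  | yes _ = <-irrefl (<-trans u<z z<v)
        ... | no _  | yes _ | no _  = <-irrefl (<-trans u<z z<v)
        sees : ∀ {u v} → height u < height v → Sees (vertices K) (λ _ _ → 0#) (_<_ on height) u v
        sees {u} {v} u<v = (λ _ → 0#) , unit , unit , u<v , λ z _ _ → unblocked {u} {z} {v}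
          where
          unit : HalfOpen (λ _ → 0#) (λ _ → 0#)
          unit _ = ≤-refl , x<x+y 0# 0<1
        panels : PanelLayout m K
        panels = record
          { base = λ _ _ → 0#
          ; height = height
          ; separated = λ {u} {v} u∈ v∈ u≢v _ _ _ eq → [ (λ lt → proj₂ lt eq) , (λ gt → proj₂ gt (sym eq)) ]
              (lower {u} {v} (ends (pair u∈ v∈ u≢v)) u≢v)
          ; visible = λ {u} {v} u∈ v∈ u≢v → mk⇔
              (λ e → Sum.map (sees {u} {v}) (sees {v} {u}) (lower {u} {v} (ends e) u≢v)) (λ _ → pair u∈ v∈ u≢v)
          }

theorem4 : ExcludedMiddle 0ℓ →
    (ℝ : Reals) (n : ℕ) .{{_ : NonZero n}} {N : ℕ} (T : Graph N) → IsTree T →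
    Σ[ a ∈ ℕ ] Σ[ b ∈ ℕ ]
    (Υh ℝ n T a × Υh⊥ ℝ (pred n) T b × + a ≡ ceiling (+ b / n))
theorem4 em ℝ (suc m) T ((_ , v∈) , _ , acyclic) =
  let (b , orthogonal , b-min) = minimum {P = Orthogonal {T = T} acyclic m} (orthogonal-exists {T = T} acyclic {m} v∈)
      (a , a≡ , b≤a*n , a-min) = ceiling-/ b m
  in a , b
   , (orthogonal⇒cubes {T = T} acyclic a (orthogonal-≤ {T = T} acyclic b≤a*n orthogonal)
     , λ j cubes → a-min j (b-min _ (cubes⇒orthogonal {T = T} acyclic cubes)))
   , (orthogonal , b-min) , a≡
  where open Arboricity em ℝ
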